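{- Let $l\ge1$ and let $n,s_1,s_2,\dots,s_l$ be positive integers. Put $w=\sum_{i=1}^l s_i$ and $I=\{s_1,\,s_1+s_2,\,\dots,\,s_1+s_2+\dots+s_{l-1}\}$ (so $I=\emptyset$ if $l=1$). Then $$\sum_{k=1}^n \genfrac{[}{]}{0pt}{}{n}{k}_q(-1)^{k}q^{\binom{k}{2}+k}\sum_{1\leq k_1<k_2<\cdots<k_l=k}\ \prod_{i=1}^l\frac{q^{(s_i-1)k_i}}{[k_i]_q^{s_i}}=(-1)^l\sum_{\substack{1\leq j_1\leq j_2\leq\dots\leq j_w\leq n\\ j_i<j_{i+1},\; i\in I}}\ \prod_{i=1}^w\frac{q^{j_i}}{[j_i]_q}$$ and $$\sum_{k=1}^n \genfrac{[}{]}{0pt}{}{n}{k}_q(-1)^{k}q^{\binom{k}{2}-nk}\sum_{\substack{1\leq j_1\leq j_2\leq\dots\leq j_w=k\\ j_i<j_{i+1},\; i\in I}}\ \prod_{i=1}^w\frac{q^{j_i}}{[j_i]_q}=(-1)^l\sum_{1\leq k_1<k_2<\cdots<k_l\leq n}\ \prod_{i=1}^l\frac{q^{(s_i-1)k_i}}{[k_i]_q^{s_i}}.$$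
   Context: Here $q$ is an indeterminate (the identities hold in $\mathbb{Q}(q)$), $[n]_q=\frac{1-q^n}{1-q}=1+q+\cdots+q^{n-1}$, and $\genfrac{[}{]}{0pt}{}{n}{k}_q=\prod_{j=1}^k\frac{1-q^{n-k+j}}{1-q^j}$ is the Gaussian $q$-binomial coefficient. In the sums over $j_1,\dots,j_w$ the inequality $j_i\le j_{i+1}$ is required for all $1\le i\le w-1$, and it is required to be strict for $i\in I$. -}

module Defs where

open import Algebra.Bundles using (CommutativeRing; Semiring)
import Algebra.Definitions.RawSemiring as RawSemiringDefinitions
import Algebra.Properties.Group as GroupProperties
import Algebra.Properties.Ring as RingProperties
import Algebra.Properties.CommutativeSemigroup as CommutativeSemigroupProperties
import Algebra.Solver.Ring.NaturalCoefficients.Default as NatSolver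
open import Data.Empty using (⊥-elim)
open import Data.Fin.Base using (Fin; toℕ)
import Data.Fin.Properties as Fin
open import Data.Integer.Base using (ℤ; +_; -[1+_])
open import Data.List.Base as List
  using (List; []; _∷_; allFin; applyUpTo; cartesianProductWith; filter; foldr)
open import Data.List.Membership.Propositional using (_∈_)
open import Data.Maybe.Base using (just)
import Data.Maybe.Properties as Maybe
open import Data.Nat.Base as ℕ using (ℕ; zero; suc)
open import Data.Nat.ListAction using (sum)
import Data.Nat.Properties as ℕ
open import Data.List.Membership.DecPropositional ℕ._≟_ using (_∈?_)
open import Data.Product.Base using (_×_; _,_)
import Data.Rational.Base as ℚ
import Data.Rational.Properties as ℚ
open import Data.Sum.Base as Sum using (_⊎_; inj₁; inj₂)
open import Data.Vec.Base as Vec using (Vec; []; _∷_; lookup; toList)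
open import Data.Vec.Relation.Unary.Linked using (Linked; linked?)
open import Level using (_⊔_; 0ℓ) renaming (suc to lsuc)
open import Relation.Binary.Bundles using (Setoid)
open import Relation.Binary.PropositionalEquality as ≡ using (_≡_)
import Relation.Binary.Reasoning.Setoid as SetoidReasoning
open import Relation.Nullary.Decidable
  using (yes; no; map′; _×-dec_; _→-dec_)
open import Relation.Nullary.Negation using (¬_)
open import Relation.Unary using (Decidable)

record DecIntegralDomain c ℓ : Set (lsuc (c ⊔ ℓ)) where
  field
    commutativeRing : CommutativeRing c ℓ

  open CommutativeRing commutativeRing public

  field
    1≉0          : ¬ 1# ≈ 0#
    _≈0?         : Decidable (_≈ 0#)
    zero-product : ∀ x y → x * y ≈ 0# → x ≈ 0# ⊎ y ≈ 0#

ℚ-domain : DecIntegralDomain 0ℓ 0ℓ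
ℚ-domain = record
  { commutativeRing = ℚ.+-*-commutativeRing
  ; 1≉0             = λ ()
  ; _≈0?            = ℚ._≟ ℚ.0ℚ
  ; zero-product    = zero-product
  }
  where
  zero-product : ∀ x y → x ℚ.* y ≡ ℚ.0ℚ → x ≡ ℚ.0ℚ ⊎ y ≡ ℚ.0ℚ
  zero-product x y xy≡0 with x ℚ.≟ ℚ.0ℚ
  ... | yes x≡0 = inj₁ x≡0
  ... | no  x≢0 = inj₂ (begin
    y                       ≡⟨ ℚ.*-identityˡ y ⟨
    ℚ.1ℚ ℚ.* y              ≡⟨ ≡.cong (ℚ._* y) (ℚ.*-inverseˡ x) ⟨
    (ℚ.1/ x) ℚ.* x ℚ.* y    ≡⟨ ℚ.*-assoc (ℚ.1/ x) x y ⟩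
    (ℚ.1/ x) ℚ.* (x ℚ.* y)  ≡⟨ ≡.cong ((ℚ.1/ x) ℚ.*_) xy≡0 ⟩
    (ℚ.1/ x) ℚ.* ℚ.0ℚ       ≡⟨ ℚ.*-zeroʳ (ℚ.1/ x) ⟩
    ℚ.0ℚ                    ∎)
    where
    open ≡.≡-Reasoning
    instance
      x-nonZero : ℚ.NonZero x
      x-nonZero = ℚ.≢-nonZero x≢0

module Polynomial {c ℓ} (D : DecIntegralDomain c ℓ) where

  private
    module D = DecIntegralDomain D
    open D using () renaming (Carrier to A; _≈_ to _≈ᴰ_)
    module DR = RingProperties D.ring

  -- Coefficients in order of increasing degree; trailing zeros are
  -- allowed and are ignored by the equality below.
  Poly : Set c
  Poly = List A

  coeff : Poly → ℕ → A
  coeff []      _       = D.0#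
  coeff (a ∷ p) zero    = a
  coeff (a ∷ p) (suc i) = coeff p i

  infix 4 _≈_
  record _≈_ (p r : Poly) : Set ℓ where
    constructor coeffwise
    field
      at : ∀ i → coeff p i ≈ᴰ coeff r i
  open _≈_

  infixl 6 _+_
  infixl 7 _*_ _·_
  infix  8 -_

  _+_ : Poly → Poly → Poly
  []      + r       = r
  (a ∷ p) + []      = a ∷ p
  (a ∷ p) + (b ∷ r) = a D.+ b ∷ p + r

  -_ : Poly → Poly
  -_ = List.map (λ a → D.- a)

  _·_ : A → Poly → Poly
  a · p = List.map (a D.*_) p

  _*_ : Poly → Poly → Poly
  []      * r = []
  (a ∷ p) * r = a · r + (D.0# ∷ p * r)

  0ₚ 1ₚ X : Poly
  0ₚ = []
  1ₚ = D.1# ∷ []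
  X  = D.0# ∷ D.1# ∷ []

  private
    ≈-refl : ∀ {p} → p ≈ p
    ≈-refl .at i = D.refl

    ≈-sym : ∀ {p r} → p ≈ r → r ≈ p
    ≈-sym e .at i = D.sym (at e i)

    ≈-trans : ∀ {p r t} → p ≈ r → r ≈ t → p ≈ t
    ≈-trans e f .at i = D.trans (at e i) (at f i)

    polySetoid : Setoid c ℓ
    polySetoid = record
      { Carrier = Poly
      ; _≈_ = _≈_
      ; isEquivalence = record
          { refl = ≈-refl ; sym = ≈-sym ; trans = ≈-trans }
      }

    ∷-cong : ∀ {a b p r} → a ≈ᴰ b → p ≈ r → (a ∷ p) ≈ (b ∷ r)
    ∷-cong e f .at zero    = e
    ∷-cong e f .at (suc i) = at f i

    0∷0 : (D.0# ∷ []) ≈ []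
    0∷0 .at zero    = D.refl
    0∷0 .at (suc i) = D.refl

    tail-≈ : ∀ {a b p r} → (a ∷ p) ≈ (b ∷ r) → p ≈ r
    tail-≈ e .at i = at e (suc i)

    tail-≈0 : ∀ {a p} → (a ∷ p) ≈ [] → p ≈ []
    tail-≈0 e .at i = at e (suc i)

    coeff-+ : ∀ p r i → coeff (p + r) i ≈ᴰ coeff p i D.+ coeff r i
    coeff-+ []      r       i       = D.sym (D.+-identityˡ _)
    coeff-+ (a ∷ p) []      i       = D.sym (D.+-identityʳ _)
    coeff-+ (a ∷ p) (b ∷ r) zero    = D.refl
    coeff-+ (a ∷ p) (b ∷ r) (suc i) = coeff-+ p r i

    coeff-neg : ∀ p i → coeff (- p) i ≈ᴰ D.- coeff p i
    coeff-neg []      i       = D.sym DR.-0#≈0#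
    coeff-neg (a ∷ p) zero    = D.refl
    coeff-neg (a ∷ p) (suc i) = coeff-neg p i

    coeff-· : ∀ a p i → coeff (a · p) i ≈ᴰ a D.* coeff p i
    coeff-· a []      i       = D.sym (D.zeroʳ a)
    coeff-· a (b ∷ p) zero    = D.refl
    coeff-· a (b ∷ p) (suc i) = coeff-· a p i

    +-cong : ∀ {p p′ r r′} → p ≈ p′ → r ≈ r′ → (p + r) ≈ (p′ + r′)
    +-cong {p} {p′} {r} {r′} e f .at i = D.trans (coeff-+ p r i)
      (D.trans (D.+-cong (at e i) (at f i)) (D.sym (coeff-+ p′ r′ i)))

    +-assoc : ∀ p r t → ((p + r) + t) ≈ (p + (r + t))
    +-assoc p r t .at i = begin
      coeff (p + r + t) i                          ≈⟨ coeff-+ (p + r) t i ⟩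
      coeff (p + r) i D.+ coeff t i                ≈⟨ D.+-congʳ (coeff-+ p r i) ⟩
      coeff p i D.+ coeff r i D.+ coeff t i        ≈⟨ D.+-assoc _ _ _ ⟩
      coeff p i D.+ (coeff r i D.+ coeff t i)      ≈⟨ D.+-congˡ (coeff-+ r t i) ⟨
      coeff p i D.+ coeff (r + t) i                ≈⟨ coeff-+ p (r + t) i ⟨
      coeff (p + (r + t)) i                        ∎
      where open SetoidReasoning D.setoid

    +-comm : ∀ p r → (p + r) ≈ (r + p)
    +-comm p r .at i = D.trans (coeff-+ p r i)
      (D.trans (D.+-comm _ _) (D.sym (coeff-+ r p i)))

    +-identityʳ : ∀ p → (p + []) ≈ p
    +-identityʳ []      = ≈-refl
    +-identityʳ (a ∷ p) = ≈-refl

    neg-cong : ∀ {p r} → p ≈ r → (- p) ≈ (- r)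
    neg-cong {p} {r} e .at i = D.trans (coeff-neg p i)
      (D.trans (D.-‿cong (at e i)) (D.sym (coeff-neg r i)))

    neg-inverseʳ : ∀ p → (p + - p) ≈ []
    neg-inverseʳ p .at i = D.trans (coeff-+ p (- p) i)
      (D.trans (D.+-congˡ (coeff-neg p i)) (D.-‿inverseʳ _))

    ·-cong : ∀ {a b p r} → a ≈ᴰ b → p ≈ r → (a · p) ≈ (b · r)
    ·-cong {a} {b} {p} {r} e f .at i = D.trans (coeff-· a p i)
      (D.trans (D.*-cong e (at f i)) (D.sym (coeff-· b r i)))

    ·-distribˡ : ∀ a p r → (a · (p + r)) ≈ (a · p + a · r)
    ·-distribˡ a p r .at i = begin
      coeff (a · (p + r)) i                        ≈⟨ coeff-· a (p + r) i ⟩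
      a D.* coeff (p + r) i                        ≈⟨ D.*-congˡ (coeff-+ p r i) ⟩
      a D.* (coeff p i D.+ coeff r i)              ≈⟨ D.distribˡ _ _ _ ⟩
      a D.* coeff p i D.+ a D.* coeff r i
        ≈⟨ D.+-cong (coeff-· a p i) (coeff-· a r i) ⟨
      coeff (a · p) i D.+ coeff (a · r) i          ≈⟨ coeff-+ (a · p) (a · r) i ⟨
      coeff (a · p + a · r) i                      ∎
      where open SetoidReasoning D.setoid

    ·-distribʳ : ∀ a b p → ((a D.+ b) · p) ≈ (a · p + b · p)
    ·-distribʳ a b p .at i = begin
      coeff ((a D.+ b) · p) i                      ≈⟨ coeff-· (a D.+ b) p i ⟩
      (a D.+ b) D.* coeff p i                      ≈⟨ D.distribʳ _ _ _ ⟩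
      a D.* coeff p i D.+ b D.* coeff p i
        ≈⟨ D.+-cong (coeff-· a p i) (coeff-· b p i) ⟨
      coeff (a · p) i D.+ coeff (b · p) i          ≈⟨ coeff-+ (a · p) (b · p) i ⟨
      coeff (a · p + b · p) i                      ∎
      where open SetoidReasoning D.setoid

    ·-assoc : ∀ a b p → ((a D.* b) · p) ≈ (a · (b · p))
    ·-assoc a b p .at i = begin
      coeff ((a D.* b) · p) i      ≈⟨ coeff-· (a D.* b) p i ⟩
      a D.* b D.* coeff p i        ≈⟨ D.*-assoc _ _ _ ⟩
      a D.* (b D.* coeff p i)      ≈⟨ D.*-congˡ (coeff-· b p i) ⟨
      a D.* coeff (b · p) i        ≈⟨ coeff-· a (b · p) i ⟨
      coeff (a · (b · p)) i        ∎
      where open SetoidReasoning D.setoid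

    0·-zero : ∀ p → (D.0# · p) ≈ []
    0·-zero p .at i = D.trans (coeff-· D.0# p i) (D.zeroˡ _)

    1·-identity : ∀ p → (D.1# · p) ≈ p
    1·-identity p .at i = D.trans (coeff-· D.1# p i) (D.*-identityˡ _)

    +-interchange : ∀ p r t u → ((p + r) + (t + u)) ≈ ((p + t) + (r + u))
    +-interchange p r t u = CommutativeSemigroupProperties.interchange
      (record { isCommutativeSemigroup = record
        { isSemigroup = record
          { isMagma = record
            { isEquivalence = Setoid.isEquivalence polySetoid
            ; ∙-cong = +-cong
            }
          ; assoc = +-assoc
          }
        ; comm = +-comm
        } }) p r t u

    shift-+ : ∀ p r → (D.0# ∷ p + r) ≈ ((D.0# ∷ p) + (D.0# ∷ r))
    shift-+ p r = ∷-cong (D.sym (D.+-identityˡ _)) ≈-refl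

    *-zeroʳ : ∀ p → (p * []) ≈ []
    *-zeroʳ []      = ≈-refl
    *-zeroʳ (a ∷ p) = ≈-trans (∷-cong D.refl (*-zeroʳ p)) 0∷0

    *-congˡ : ∀ p {r r′} → r ≈ r′ → (p * r) ≈ (p * r′)
    *-congˡ []      e = ≈-refl
    *-congˡ (a ∷ p) e = +-cong (·-cong D.refl e) (∷-cong D.refl (*-congˡ p e))

    *-∷ʳ : ∀ p b r → (p * (b ∷ r)) ≈ (b · p + (D.0# ∷ p * r))
    *-∷ʳ []      b r = ≈-sym 0∷0
    *-∷ʳ (a ∷ p) b r = ∷-cong (D.+-congʳ (D.*-comm a b)) (begin
      a · r + p * (b ∷ r)                 ≈⟨ +-cong ≈-refl (*-∷ʳ p b r) ⟩
      a · r + (b · p + (D.0# ∷ p * r))    ≈⟨ +-assoc (a · r) (b · p) _ ⟨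
      a · r + b · p + (D.0# ∷ p * r)      ≈⟨ +-cong (+-comm (a · r) (b · p)) ≈-refl ⟩
      b · p + a · r + (D.0# ∷ p * r)      ≈⟨ +-assoc (b · p) (a · r) _ ⟩
      b · p + (a · r + (D.0# ∷ p * r))    ∎)
      where open SetoidReasoning polySetoid

    *-comm : ∀ p r → (p * r) ≈ (r * p)
    *-comm []      r = ≈-sym (*-zeroʳ r)
    *-comm (a ∷ p) r = ≈-trans
      (+-cong ≈-refl (∷-cong D.refl (*-comm p r))) (≈-sym (*-∷ʳ r a p))

    *-cong : ∀ {p p′ r r′} → p ≈ p′ → r ≈ r′ → (p * r) ≈ (p′ * r′)
    *-cong {p} {p′} {r} {r′} e f = ≈-trans (*-congˡ p f) (≈-trans (*-comm p r′)
      (≈-trans (*-congˡ r′ e) (*-comm r′ p′)))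

    *-distribʳ : ∀ r p t → ((p + t) * r) ≈ (p * r + t * r)
    *-distribʳ r []      t       = ≈-refl
    *-distribʳ r (a ∷ p) []      = ≈-sym (+-identityʳ _)
    *-distribʳ r (a ∷ p) (b ∷ t) = ≈-trans
      (+-cong (·-distribʳ a b r)
        (≈-trans (∷-cong D.refl (*-distribʳ r p t)) (shift-+ (p * r) (t * r))))
      (+-interchange (a · r) (b · r) _ _)

    *-distribˡ : ∀ r p t → (r * (p + t)) ≈ (r * p + r * t)
    *-distribˡ r p t = ≈-trans (*-comm r (p + t)) (≈-trans (*-distribʳ r p t)
      (+-cong (*-comm p r) (*-comm t r)))

    shift-* : ∀ p r → ((D.0# ∷ p) * r) ≈ (D.0# ∷ p * r)
    shift-* p r = +-cong (0·-zero r) (≈-refl {D.0# ∷ p * r})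

    ·-*-assoc : ∀ a p r → ((a · p) * r) ≈ (a · (p * r))
    ·-*-assoc a []      r = ≈-refl
    ·-*-assoc a (b ∷ p) r = ≈-trans
      (+-cong (·-assoc a b r)
        (∷-cong (D.sym (D.zeroʳ a)) (·-*-assoc a p r)))
      (≈-sym (·-distribˡ a (b · r) (D.0# ∷ p * r)))

    *-assoc : ∀ p r t → ((p * r) * t) ≈ (p * (r * t))
    *-assoc []      r t = ≈-refl
    *-assoc (a ∷ p) r t = ≈-trans (*-distribʳ t (a · r) (D.0# ∷ p * r))
      (+-cong (·-*-assoc a r t)
        (≈-trans (shift-* (p * r) t) (∷-cong D.refl (*-assoc p r t))))

    *-identityˡ : ∀ p → (1ₚ * p) ≈ p
    *-identityˡ p = ≈-trans (+-cong (1·-identity p) 0∷0) (+-identityʳ p)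

  polynomialRing : CommutativeRing c ℓ
  polynomialRing = record
    { Carrier = Poly ; _≈_ = _≈_ ; _+_ = _+_ ; _*_ = _*_ ; -_ = -_
    ; 0# = 0ₚ ; 1# = 1ₚ
    ; isCommutativeRing = record
      { isRing = record
        { +-isAbelianGroup = record
          { isGroup = record
            { isMonoid = record
              { isSemigroup = record
                { isMagma = record
                  { isEquivalence = Setoid.isEquivalence polySetoid
                  ; ∙-cong = +-cong
                  }
                ; assoc = +-assoc
                }
              ; identity = (λ _ → ≈-refl) , +-identityʳ
              }
            ; inverse = (λ p → ≈-trans (+-comm (- p) p) (neg-inverseʳ p))
                      , neg-inverseʳ
            ; ⁻¹-cong = neg-cong
            }
          ; comm = +-comm
          }
        ; *-cong     = *-cong
        ; *-assoc    = *-assoc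
        ; *-identity = *-identityˡ
                     , (λ p → ≈-trans (*-comm p 1ₚ) (*-identityˡ p))
        ; distrib    = *-distribˡ , *-distribʳ
        }
      ; *-comm = *-comm
      }
    }

  private
    zero? : Decidable (_≈ 0ₚ)
    zero? []      = yes ≈-refl
    zero? (a ∷ p) = map′ (λ (e , f) → ≈-trans (∷-cong e f) 0∷0)
                         (λ e → at e 0 , tail-≈0 e)
                         ((a D.≈0?) ×-dec zero? p)

    zero-∷ : ∀ {a p} → a ≈ᴰ D.0# → p ≈ [] → (a ∷ p) ≈ []
    zero-∷ e f = ≈-trans (∷-cong e f) 0∷0

    zero-product-step : ∀ a p b r →
      ((p * (b ∷ r)) ≈ [] → p ≈ [] ⊎ (b ∷ r) ≈ []) →
      (((a ∷ p) * r) ≈ [] → (a ∷ p) ≈ [] ⊎ r ≈ []) →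
      ((a ∷ p) * (b ∷ r)) ≈ [] → (a ∷ p) ≈ [] ⊎ (b ∷ r) ≈ []
    zero-product-step a p b r rec₁ rec₂ e with a D.≈0?
    ... | yes a≈0 = Sum.map₁ (zero-∷ a≈0) (rec₁ (tail-≈0 (begin
      D.0# ∷ p * (b ∷ r)       ≈⟨ shift-* p (b ∷ r) ⟨
      (D.0# ∷ p) * (b ∷ r)
        ≈⟨ *-cong {D.0# ∷ p} {a ∷ p} {b ∷ r} (∷-cong (D.sym a≈0) ≈-refl) ≈-refl ⟩
      (a ∷ p) * (b ∷ r)        ≈⟨ e ⟩
      []                       ∎)))
      where open SetoidReasoning polySetoid
    ... | no  a≉0 with D.zero-product a b
                       (D.trans (D.sym (D.+-identityʳ _)) (at e 0))
    ...   | inj₁ a≈0 = ⊥-elim (a≉0 a≈0)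
    ...   | inj₂ b≈0 = Sum.map₂ (zero-∷ b≈0) (rec₂ (tail-≈0 (begin
      D.0# ∷ (a ∷ p) * r       ≈⟨ ∷-cong D.refl (*-comm (a ∷ p) r) ⟩
      D.0# ∷ r * (a ∷ p)       ≈⟨ shift-* r (a ∷ p) ⟨
      (D.0# ∷ r) * (a ∷ p)     ≈⟨ *-comm (D.0# ∷ r) (a ∷ p) ⟩
      (a ∷ p) * (D.0# ∷ r)     ≈⟨ *-congˡ (a ∷ p) (∷-cong (D.sym b≈0) ≈-refl) ⟩
      (a ∷ p) * (b ∷ r)        ≈⟨ e ⟩
      []                       ∎)))
      where open SetoidReasoning polySetoid

    zero-product : ∀ p r → (p * r) ≈ [] → p ≈ [] ⊎ r ≈ []
    zero-product []      r       e = inj₁ ≈-refl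
    zero-product (a ∷ p) []      e = inj₂ ≈-refl
    zero-product (a ∷ p) (b ∷ r) e =
      zero-product-step a p b r (zero-product p (b ∷ r)) (zero-product (a ∷ p) r) e

  polynomialDomain : DecIntegralDomain c ℓ
  polynomialDomain = record
    { commutativeRing = polynomialRing
    ; 1≉0             = λ e → D.1≉0 (at e 0)
    ; _≈0?            = zero?
    ; zero-product    = zero-product
    }

module FractionField {c ℓ} (D : DecIntegralDomain c ℓ) where

  private
    module D = DecIntegralDomain D
    open D using () renaming (Carrier to A; _≈_ to _≈ᴰ_)
    module S = NatSolver D.commutativeSemiring
    open S using (_:=_; _:+_; _:*_)
    open SetoidReasoning D.setoid

  record Fraction : Set (c ⊔ ℓ) where
    constructor _over_⟨_⟩
    field
      num   : A
      den   : A
      den≉0 : ¬ den ≈ᴰ D.0#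
  open Fraction

  infix 4 _≈_
  data _≈_ (x y : Fraction) : Set ℓ where
    cross : num x D.* den y ≈ᴰ num y D.* den x → x ≈ y

  private
    *-≉0 : ∀ {a b} → ¬ a ≈ᴰ D.0# → ¬ b ≈ᴰ D.0# → ¬ a D.* b ≈ᴰ D.0#
    *-≉0 {a} {b} a≉0 b≉0 e = Sum.[ a≉0 , b≉0 ] (D.zero-product a b e)

  embed : A → Fraction
  embed a = a over D.1# ⟨ D.1≉0 ⟩

  infixl 6 _+_
  infixl 7 _*_
  infix  8 -_ _⁻¹

  _+_ _*_ : Fraction → Fraction → Fraction
  (a over b ⟨ b≉0 ⟩) + (c over d ⟨ d≉0 ⟩) =
    (a D.* d D.+ c D.* b) over (b D.* d) ⟨ *-≉0 b≉0 d≉0 ⟩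
  (a over b ⟨ b≉0 ⟩) * (c over d ⟨ d≉0 ⟩) =
    (a D.* c) over (b D.* d) ⟨ *-≉0 b≉0 d≉0 ⟩

  -_ : Fraction → Fraction
  - (a over b ⟨ b≉0 ⟩) = (D.- a) over b ⟨ b≉0 ⟩

  0ᶠ 1ᶠ : Fraction
  0ᶠ = embed D.0#
  1ᶠ = embed D.1#

  -- Total inverse, with the convention that the inverse of zero is zero.
  _⁻¹ : Fraction → Fraction
  (a over b ⟨ b≉0 ⟩) ⁻¹ with a D.≈0?
  ... | yes _   = 0ᶠ
  ... | no  a≉0 = b over a ⟨ a≉0 ⟩

  private
    *-cancelʳ : ∀ {x y z} → ¬ z ≈ᴰ D.0# → x D.* z ≈ᴰ y D.* z → x ≈ᴰ y
    *-cancelʳ {x} {y} {z} z≉0 e with D.zero-product (x D.- y) z (begin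
        (x D.- y) D.* z                ≈⟨ D.distribʳ z x (D.- y) ⟩
        x D.* z D.+ (D.- y) D.* z      ≈⟨ D.+-congˡ (RingProperties.-‿distribˡ-* D.ring y z) ⟨
        x D.* z D.+ D.- (y D.* z)      ≈⟨ D.+-congʳ e ⟩
        y D.* z D.+ D.- (y D.* z)      ≈⟨ D.-‿inverseʳ (y D.* z) ⟩
        D.0#                           ∎)
    ... | inj₁ x-y≈0 = GroupProperties.x∙y⁻¹≈ε⇒x≈y D.+-group x y x-y≈0
    ... | inj₂ z≈0   = ⊥-elim (z≉0 z≈0)

    ≈-refl : ∀ {x} → x ≈ x
    ≈-refl = cross D.refl

    ≈-sym : ∀ {x y} → x ≈ y → y ≈ x
    ≈-sym (cross e) = cross (D.sym e)

    ≈-trans : ∀ {x y z} → x ≈ y → y ≈ z → x ≈ z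
    ≈-trans {a over b ⟨ _ ⟩} {c over d ⟨ d≉0 ⟩} {e over f ⟨ _ ⟩} (cross p) (cross r) =
      cross (*-cancelʳ d≉0 (begin
        a D.* f D.* d    ≈⟨ swap a f d ⟩
        a D.* d D.* f    ≈⟨ D.*-congʳ p ⟩
        c D.* b D.* f    ≈⟨ swap c b f ⟩
        c D.* f D.* b    ≈⟨ D.*-congʳ r ⟩
        e D.* d D.* b    ≈⟨ swap e d b ⟩
        e D.* b D.* d    ∎))
      where
      swap : ∀ x y z → x D.* y D.* z ≈ᴰ x D.* z D.* y
      swap = S.solve 3 (λ x y z → (x :* y) :* z := (x :* z) :* y) D.refl

    +-cong : ∀ {x x′ y y′} → x ≈ x′ → y ≈ y′ → (x + y) ≈ (x′ + y′)
    +-cong {a over b ⟨ _ ⟩} {a′ over b′ ⟨ _ ⟩} {c over d ⟨ _ ⟩} {c′ over d′ ⟨ _ ⟩}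
      (cross e) (cross f) = cross (begin
        (a D.* d D.+ c D.* b) D.* (b′ D.* d′)
          ≈⟨ S.solve 6 (λ a b c d b′ d′ →
               (a :* d :+ c :* b) :* (b′ :* d′) :=
               (a :* b′) :* (d :* d′) :+ (c :* d′) :* (b :* b′)) D.refl a b c d b′ d′ ⟩
        (a D.* b′) D.* (d D.* d′) D.+ (c D.* d′) D.* (b D.* b′)
          ≈⟨ D.+-cong (D.*-congʳ e) (D.*-congʳ f) ⟩
        (a′ D.* b) D.* (d D.* d′) D.+ (c′ D.* d) D.* (b D.* b′)
          ≈⟨ S.solve 6 (λ a′ b c′ d b′ d′ →
               (a′ :* b) :* (d :* d′) :+ (c′ :* d) :* (b :* b′) :=
               (a′ :* d′ :+ c′ :* b′) :* (b :* d)) D.refl a′ b c′ d b′ d′ ⟩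
        (a′ D.* d′ D.+ c′ D.* b′) D.* (b D.* d)  ∎)

    *-cong : ∀ {x x′ y y′} → x ≈ x′ → y ≈ y′ → (x * y) ≈ (x′ * y′)
    *-cong {a over b ⟨ _ ⟩} {a′ over b′ ⟨ _ ⟩} {c over d ⟨ _ ⟩} {c′ over d′ ⟨ _ ⟩}
      (cross e) (cross f) = cross (begin
        (a D.* c) D.* (b′ D.* d′)    ≈⟨ medial a c b′ d′ ⟩
        (a D.* b′) D.* (c D.* d′)    ≈⟨ D.*-cong e f ⟩
        (a′ D.* b) D.* (c′ D.* d)    ≈⟨ medial a′ b c′ d ⟩
        (a′ D.* c′) D.* (b D.* d)    ∎)
      where
      medial : ∀ x y z w → (x D.* y) D.* (z D.* w) ≈ᴰ (x D.* z) D.* (y D.* w)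
      medial = S.solve 4 (λ x y z w →
        (x :* y) :* (z :* w) := (x :* z) :* (y :* w)) D.refl

    neg-cong : ∀ {x y} → x ≈ y → (- x) ≈ (- y)
    neg-cong {a over b ⟨ _ ⟩} {c over d ⟨ _ ⟩} (cross e) = cross (begin
      (D.- a) D.* d      ≈⟨ RingProperties.-‿distribˡ-* D.ring a d ⟨
      D.- (a D.* d)      ≈⟨ D.-‿cong e ⟩
      D.- (c D.* b)      ≈⟨ RingProperties.-‿distribˡ-* D.ring c b ⟩
      (D.- c) D.* b      ∎)

    +-assoc : ∀ x y z → ((x + y) + z) ≈ (x + (y + z))
    +-assoc (a over b ⟨ _ ⟩) (c over d ⟨ _ ⟩) (e over f ⟨ _ ⟩) = cross
      (S.solve 6 (λ a b c d e f →
        ((a :* d :+ c :* b) :* f :+ e :* (b :* d)) :* (b :* (d :* f)) :=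
        (a :* (d :* f) :+ (c :* f :+ e :* d) :* b) :* ((b :* d) :* f))
        D.refl a b c d e f)

    +-comm : ∀ x y → (x + y) ≈ (y + x)
    +-comm (a over b ⟨ _ ⟩) (c over d ⟨ _ ⟩) = cross
      (S.solve 4 (λ a b c d →
        (a :* d :+ c :* b) :* (d :* b) := (c :* b :+ a :* d) :* (b :* d))
        D.refl a b c d)

    +-identityˡ : ∀ x → (0ᶠ + x) ≈ x
    +-identityˡ (a over b ⟨ _ ⟩) = cross (D.*-cong
      (D.trans (D.+-cong (D.zeroˡ b) (D.*-identityʳ a)) (D.+-identityˡ a))
      (D.sym (D.*-identityˡ b)))

    neg-inverseˡ : ∀ x → (- x + x) ≈ 0ᶠ
    neg-inverseˡ (a over b ⟨ _ ⟩) = cross (begin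
      ((D.- a) D.* b D.+ a D.* b) D.* D.1#   ≈⟨ D.*-identityʳ _ ⟩
      (D.- a) D.* b D.+ a D.* b              ≈⟨ D.distribʳ b (D.- a) a ⟨
      (D.- a D.+ a) D.* b                    ≈⟨ D.*-congʳ (D.-‿inverseˡ a) ⟩
      D.0# D.* b                             ≈⟨ D.zeroˡ b ⟩
      D.0#                                   ≈⟨ D.zeroˡ _ ⟨
      D.0# D.* (b D.* b)                     ∎)

    *-assoc : ∀ x y z → ((x * y) * z) ≈ (x * (y * z))
    *-assoc (a over b ⟨ _ ⟩) (c over d ⟨ _ ⟩) (e over f ⟨ _ ⟩) = cross
      (D.*-cong (D.*-assoc a c e) (D.sym (D.*-assoc b d f)))

    *-comm : ∀ x y → (x * y) ≈ (y * x)
    *-comm (a over b ⟨ _ ⟩) (c over d ⟨ _ ⟩) = cross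
      (D.*-cong (D.*-comm a c) (D.*-comm d b))

    *-identityˡ : ∀ x → (1ᶠ * x) ≈ x
    *-identityˡ (a over b ⟨ _ ⟩) = cross
      (D.*-cong (D.*-identityˡ a) (D.sym (D.*-identityˡ b)))

    *-distribˡ : ∀ x y z → (x * (y + z)) ≈ (x * y + x * z)
    *-distribˡ (a over b ⟨ _ ⟩) (c over d ⟨ _ ⟩) (e over f ⟨ _ ⟩) = cross
      (S.solve 6 (λ a b c d e f →
        (a :* (c :* f :+ e :* d)) :* ((b :* d) :* (b :* f)) :=
        ((a :* c) :* (b :* f) :+ (a :* e) :* (b :* d)) :* (b :* (d :* f)))
        D.refl a b c d e f)

  fractionField : CommutativeRing (c ⊔ ℓ) ℓ
  fractionField = record
    { Carrier = Fraction ; _≈_ = _≈_ ; _+_ = _+_ ; _*_ = _*_ ; -_ = -_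
    ; 0# = 0ᶠ ; 1# = 1ᶠ
    ; isCommutativeRing = record
      { isRing = record
        { +-isAbelianGroup = record
          { isGroup = record
            { isMonoid = record
              { isSemigroup = record
                { isMagma = record
                  { isEquivalence = record
                      { refl = ≈-refl ; sym = ≈-sym ; trans = ≈-trans }
                  ; ∙-cong = +-cong
                  }
                ; assoc = +-assoc
                }
              ; identity = +-identityˡ
                         , (λ x → ≈-trans (+-comm x 0ᶠ) (+-identityˡ x))
              }
            ; inverse = neg-inverseˡ
                      , (λ x → ≈-trans (+-comm x (- x)) (neg-inverseˡ x))
            ; ⁻¹-cong = neg-cong
            }
          ; comm = +-comm
          }
        ; *-cong     = *-cong
        ; *-assoc    = *-assoc
        ; *-identity = *-identityˡ
                     , (λ x → ≈-trans (*-comm x 1ᶠ) (*-identityˡ x))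
        ; distrib    = *-distribˡ
                     , (λ x y z → ≈-trans (*-comm (y + z) x)
                         (≈-trans (*-distribˡ x y z)
                           (+-cong (*-comm x y) (*-comm x z))))
        }
      ; *-comm = *-comm
      }
    }

  ⁻¹-inverseʳ : ∀ x → ¬ x ≈ 0ᶠ → (x * x ⁻¹) ≈ 1ᶠ
  ⁻¹-inverseʳ (a over b ⟨ _ ⟩) x≉0 with a D.≈0?
  ... | yes a≈0 = ⊥-elim (x≉0 (cross (D.trans (D.*-identityʳ a)
                    (D.trans a≈0 (D.sym (D.zeroˡ b))))))
  ... | no  _   = cross (D.trans (D.*-identityʳ _)
                    (D.trans (D.*-comm a b) (D.sym (D.*-identityˡ _))))

[1⋯_] : ℕ → List ℕ
[1⋯ n ] = applyUpTo suc n

tuples : ℕ → ∀ m → List (Vec ℕ m)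
tuples n zero    = [] ∷ []
tuples n (suc m) = cartesianProductWith _∷_ [1⋯ n ] (tuples n m)

EndsIn : ℕ → ∀ {m} → Vec ℕ m → Set
EndsIn k v = List.last (toList v) ≡ just k

endsIn? : ∀ k {m} → Decidable (EndsIn k {m})
endsIn? k v = Maybe.≡-dec ℕ._≟_ (List.last (toList v)) (just k)

-- jᵢ ≤ jᵢ₊₁ for 1 ≤ i < w, strictly for i ∈ I.  Here a and b are the
-- zero-based positions of jᵢ and jᵢ₊₁, so that i = toℕ b.
Chain : List ℕ → ∀ {w} → Vec ℕ w → Set
Chain I {w} j = (a b : Fin w) → toℕ b ≡ suc (toℕ a) →
  lookup j a ℕ.≤ lookup j b × (toℕ b ∈ I → lookup j a ℕ.< lookup j b)

chain? : ∀ I {w} → Decidable (Chain I {w})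
chain? I j = Fin.all? λ a → Fin.all? λ b →
  (toℕ b ℕ.≟ suc (toℕ a)) →-dec
    ((lookup j a ℕ.≤? lookup j b) ×-dec
      ((toℕ b ∈? I) →-dec (lookup j a ℕ.<? lookup j b)))

-- 1 ≤ k₁ < k₂ < ⋯ < kₗ ≤ n, and the same with kₗ = k.
strictTuples≤ : ℕ → ∀ l → List (Vec ℕ l)
strictTuples≤ n l = filter (linked? ℕ._<?_) (tuples n l)

strictTuples= : ℕ → ∀ l → List (Vec ℕ l)
strictTuples= k l = filter (endsIn? k) (strictTuples≤ k l)

-- 1 ≤ j₁ ≤ j₂ ≤ ⋯ ≤ j_w ≤ n with strictness at I, and the same with j_w = k.
chains≤ : List ℕ → ℕ → ∀ w → List (Vec ℕ w)
chains≤ I n w = filter (chain? I) (tuples n w)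

chains= : List ℕ → ℕ → ∀ w → List (Vec ℕ w)
chains= I k w = filter (endsIn? k) (chains≤ I k w)

-- { s₁ , s₁ + s₂ , … , s₁ + ⋯ + sₗ₋₁ }
partialSums : ∀ {l} → Vec ℕ l → List ℕ
partialSums {l} s =
  List.map (λ r → sum (List.take r (toList s))) [1⋯ l ℕ.∸ 1 ]

module QAnalogues {c ℓ} (K : CommutativeRing c ℓ)
  (_⁻¹ : CommutativeRing.Carrier K → CommutativeRing.Carrier K)
  (q : CommutativeRing.Carrier K) where

  open CommutativeRing K

  open RawSemiringDefinitions (Semiring.rawSemiring semiring) public using (_^_)

  infixl 7 _/_
  _/_ : Carrier → Carrier → Carrier
  x / y = x * (y ⁻¹)

  infixr 8 _^ℤ_
  _^ℤ_ : Carrier → ℤ → Carrier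
  x ^ℤ (+ n)    = x ^ n
  x ^ℤ -[1+ n ] = (x ⁻¹) ^ suc n

  module _ {a} {A : Set a} where

    ∑ ∏ : List A → (A → Carrier) → Carrier
    ∑ xs f = foldr _+_ 0# (List.map f xs)
    ∏ xs f = foldr _*_ 1# (List.map f xs)

  infixr 6 ∑-syntax
  infixr 7 ∏-syntax

  ∑-syntax ∏-syntax : ∀ {a} {A : Set a} → List A → (A → Carrier) → Carrier
  ∑-syntax = ∑
  ∏-syntax = ∏

  syntax ∑-syntax xs (λ x → e) = ∑[ x ∈ xs ] e
  syntax ∏-syntax xs (λ x → e) = ∏[ x ∈ xs ] e

  [_]q : ℕ → Carrier
  [ n ]q = (1# - q ^ n) / (1# - q)

  -- The truncated subtraction n ∸ k is genuine whenever k ≤ n, which is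
  -- the only range in which the coefficient is used.
  qBinomial : ℕ → ℕ → Carrier
  qBinomial n k =
    ∏[ j ∈ [1⋯ k ] ] ((1# - q ^ (n ℕ.∸ k ℕ.+ j)) / (1# - q ^ j))

  strictTerm : ∀ {l} → Vec ℕ l → Vec ℕ l → Carrier
  strictTerm {l} s k = ∏[ i ∈ allFin l ]
    (q ^ ((lookup s i ℕ.∸ 1) ℕ.* lookup k i) / [ lookup k i ]q ^ lookup s i)

  chainTerm : ∀ {w} → Vec ℕ w → Carrier
  chainTerm {w} j = ∏[ i ∈ allFin w ] (q ^ lookup j i / [ lookup j i ]q)

module ℚ[q] = Polynomial ℚ-domain
module ℚ⟨q⟩ = FractionField ℚ[q].polynomialDomain

q : ℚ⟨q⟩.Fraction
q = ℚ⟨q⟩.embed ℚ[q].X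

open CommutativeRing ℚ⟨q⟩.fractionField public
  using (_≈_; _+_; _*_; -_; _-_; 0#; 1#)
open QAnalogues ℚ⟨q⟩.fractionField ℚ⟨q⟩._⁻¹ q public

-- Both sides are nested sums, so each arises from the sequence δ = (1, 0, 0, …)
-- by applying one transfer operator "weight times partial sum" per summation
-- variable.  Call φ and ψ dual if Σ_{k≤n} c(n,k) φ(k) = ε Σ_{k≤n} ψ(k) for all
-- n.  Then δ is dual to itself, and duality survives each letter of the word
-- (s₁, …, sₗ): a new block kᵢ turns (φ, ψ) into sums over strictly smaller
-- indices and flips the sign of ε, while raising sᵢ by one multiplies one
-- sequence by qᵏ/[k] and takes a weak partial sum of the other.  Both facts
-- follow by telescoping in n and one summation by parts, from the two Pascal
-- recurrences of the Gaussian binomials.  The two identities are the cases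
-- c(n,k) = (-1)ᵏ q^(k(k-1)/2 + k) [n k] and c(n,k) = (-1)ᵏ q^(k(k-1)/2 - nk) [n k].

module Submission where

open import Algebra.Bundles using (CommutativeRing)
import Algebra.Properties.AbelianGroup as AbelianGroupProperties
import Algebra.Properties.CommutativeSemiring.Exp as Exp
import Algebra.Properties.Group as GroupProperties
import Algebra.Properties.Ring as RingProperties
import Algebra.Properties.Semiring.Mult.TCOptimised as Mult
import Algebra.Solver.Ring as RingSolver
open import Algebra.Solver.Ring.AlmostCommutativeRing
  using (fromCommutativeRing; _-Raw-AlmostCommutative⟶_)
open import Data.Bool.Base using (Bool; true; false; if_then_else_)
open import Data.Empty using (⊥-elim)
open import Data.Fin.Base using (Fin; zero; suc; toℕ)
open import Data.Integer.Base as ℤ using (ℤ; +_; -[1+_]; _⊖_; _◃_)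
import Data.Integer.Properties as ℤ
open import Data.List.Base as List
  using (List; []; _∷_; allFin; applyUpTo; cartesianProductWith; filter)
open import Data.List.Membership.Propositional using (_∈_)
open import Data.List.Membership.Propositional.Properties using (∈-map⁺; ∈-map⁻)
open import Data.List.Properties using (map-applyUpTo; map-tabulate)
open import Data.List.Relation.Unary.Any using (here; there)
open import Data.Maybe.Base as Maybe using (Maybe; just)
import Data.Maybe.Properties as Maybe
open import Data.Nat.Base as ℕ using (ℕ; zero; suc; _≤_; _<_; z≤n; s≤s)
open import Data.Nat.Combinatorics using (_C_; nCk+nC[k+1]≡[n+1]C[k+1]; nC1≡n)
import Data.Nat.Properties as ℕ
open import Data.Product.Base using (_×_; _,_)
import Data.Rational.Base as ℚ
import Data.Rational.Properties as ℚ
import Data.Sign.Base as Sign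
open import Data.Unit.Base using (⊤; tt)
open import Data.Vec.Base as Vec using (Vec; []; _∷_; _++_; lookup; replicate)
open import Data.Vec.Properties using (lookup-map; lookup-replicate)
open import Data.Vec.Relation.Unary.All using (All; []; _∷_)
open import Data.Vec.Relation.Unary.Linked using (Linked; [-]; _∷_; linked?)
open import Function.Base using (_∘_)
open import Function.Bundles using (_⇔_; mk⇔; Equivalence)
open import Relation.Binary.Consequences using (dec⇒weaklyDec)
open import Relation.Binary.PropositionalEquality as ≡ using (_≡_)
import Relation.Binary.Reasoning.Setoid as SetoidReasoning
open import Relation.Nullary.Decidable
  using (Dec; yes; no; does; _×-dec_; does-⇔; dec-true; dec-false)
open import Relation.Nullary.Negation using (¬_)
open import Relation.Nullary.Reflects using (Reflects; ofʸ; ofⁿ)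
open import Relation.Unary using (Decidable)

open import Defs using
  ( EndsIn; endsIn?; Chain; chain?; partialSums; [1⋯_]; tuples
  ; strictTuples≤; strictTuples=; chains≤; chains=; module QAnalogues )

-- Strictness flags and chains

flags : ∀ {l} (s : Vec ℕ l) → Vec Bool (Vec.sum s)
flags []          = []
flags (zero  ∷ s) = flags s
flags (suc t ∷ s) = true ∷ replicate t false ++ flags s

bound : Bool → ℕ → ℕ
bound true  j = j
bound false j = suc j

-- m < bound b j means m < j or m ≤ j, according to the flag b.
Path : ∀ {w} → Vec Bool w → ℕ → Vec ℕ w → Set
Path []      m []       = ⊤
Path (b ∷ β) m (j ∷ js) = m < bound b j × Path β j js

path? : ∀ {w} (β : Vec Bool w) m → Decidable (Path β m)
path? []      m []       = yes tt
path? (b ∷ β) m (j ∷ js) = (m ℕ.<? bound b j) ×-dec path? β j js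

end : ∀ {w} → ℕ → Vec ℕ w → ℕ
end m []       = m
end m (j ∷ js) = end j js

last≡end : ∀ {w} m (js : Vec ℕ w) → List.last (Vec.toList (m ∷ js)) ≡ just (end m js)
last≡end m []       = ≡.refl
last≡end m (j ∷ js) = last≡end j js

endsIn⇔ : ∀ {w} k m (js : Vec ℕ w) → EndsIn k (m ∷ js) ⇔ end m js ≡ k
endsIn⇔ k m js = mk⇔
  (λ e → Maybe.just-injective (≡.trans (≡.sym (last≡end m js)) e))
  (λ e → ≡.trans (last≡end m js) (≡.cong just e))

linked⇔path : ∀ {l} m (ks : Vec ℕ l) → Linked _<_ (m ∷ ks) ⇔ Path (replicate l true) m ks
linked⇔path m []       = mk⇔ (λ _ → tt) (λ _ → [-])
linked⇔path m (k ∷ ks) = mk⇔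
  (λ { (m<k ∷ L) → m<k , Equivalence.to (linked⇔path k ks) L })
  (λ (m<k , p) → m<k ∷ Equivalence.from (linked⇔path k ks) p)

IsChain : (ℕ → Set) → ∀ {w} → Vec ℕ w → Set
IsChain P {w} j = (a b : Fin w) → toℕ b ≡ suc (toℕ a) →
  lookup j a ≤ lookup j b × (P (toℕ b) → lookup j a < lookup j b)

-- The head of β is the flag of index 1, since index 0 has no predecessor.
Marks : ∀ {w} → (ℕ → Set) → Vec Bool w → Set
Marks P []      = ⊤
Marks P (b ∷ β) = Reflects (P 1) b × Marks (λ i → P (suc i)) β

chain⇒path : ∀ {w} {P} {β : Vec Bool w} → Marks P β → ∀ m js →
  IsChain P (m ∷ js) → Path β m js
chain⇒path {β = []}    _       m []       h = tt
chain⇒path {β = b ∷ β} (r , M) m (j ∷ js) h =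
  first r (h zero (suc zero) ≡.refl) ,
  chain⇒path M j js (λ a b e → h (suc a) (suc b) (≡.cong suc e))
  where
  first : ∀ {b A} → Reflects A b → m ≤ j × (A → m < j) → m < bound b j
  first (ofʸ a) (_ , f) = f a
  first (ofⁿ _) (m≤j , _) = s≤s m≤j

path⇒chain : ∀ {w} {P} {β : Vec Bool w} → Marks P β → ∀ m js →
  Path β m js → IsChain P (m ∷ js)
path⇒chain {β = []}    _       m []       _       _       zero          ()
path⇒chain {β = b ∷ β} (r , M) m (j ∷ js) (p , _) zero    (suc zero)    _ = first r p
  where
  first : ∀ {b A} → Reflects A b → m < bound b j → m ≤ j × (A → m < j)
  first (ofʸ _)  m<j       = ℕ.<⇒≤ m<j , λ _ → m<j
  first (ofⁿ ¬a) (s≤s m≤j) = m≤j , λ a → ⊥-elim (¬a a)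
path⇒chain {β = b ∷ β} (r , M) m (j ∷ js) (_ , p) (suc a) (suc b′)      e =
  path⇒chain M j js p a b′ (ℕ.suc-injective e)

marks-cong : ∀ {w} {P Q : ℕ → Set} (β : Vec Bool w) →
  (∀ i → P (suc i) ⇔ Q (suc i)) → Marks P β → Marks Q β
marks-cong []      e _       = tt
marks-cong (b ∷ β) e (r , M) = first (e 0) r , marks-cong β (λ i → e (suc i)) M
  where
  first : ∀ {b} {A B : Set} → A ⇔ B → Reflects A b → Reflects B b
  first e (ofʸ a)  = ofʸ (Equivalence.to e a)
  first e (ofⁿ ¬a) = ofⁿ (λ b → ¬a (Equivalence.from e b))

marks-++ : ∀ t {w P} {β : Vec Bool w} → (∀ i → suc i ≤ t → ¬ P (suc i)) →
  Marks (λ i → P (t ℕ.+ i)) β → Marks P (replicate t false ++ β)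
marks-++ zero    ¬P M = M
marks-++ (suc t) ¬P M = ofⁿ (¬P 0 (s≤s z≤n)) , marks-++ t (λ i i≤t → ¬P (suc i) (s≤s i≤t)) M

partialSums-∷ : ∀ {l} x y (s : Vec ℕ l) →
  partialSums (x ∷ y ∷ s) ≡ x ∷ List.map (x ℕ.+_) (partialSums (y ∷ s))
partialSums-∷ {l} x y s = ≡.cong₂ _∷_ (ℕ.+-identityʳ x) (≡.trans
  (map-applyUpTo (λ i → suc (suc i)) _ l)
  (≡.sym (≡.trans (≡.cong (List.map (x ℕ.+_)) (map-applyUpTo suc _ l))
                  (map-applyUpTo _ (x ℕ.+_) l))))

∈-shift⇔ : ∀ t xs i → suc i ∈ xs ⇔ t ℕ.+ suc (suc i) ∈ suc t ∷ List.map (suc t ℕ.+_) xs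
∈-shift⇔ t xs i = mk⇔
  (λ x∈ → there (≡.subst (_∈ List.map (suc t ℕ.+_) xs)
    (≡.sym (ℕ.+-suc t (suc i))) (∈-map⁺ (suc t ℕ.+_) x∈)))
  from
  where
  from : t ℕ.+ suc (suc i) ∈ suc t ∷ List.map (suc t ℕ.+_) xs → suc i ∈ xs
  from (here e)    = ⊥-elim (ℕ.m+1+n≢m t
    (ℕ.suc-injective (≡.trans (≡.sym (ℕ.+-suc t (suc i))) e)))
  from (there i∈) with ∈-map⁻ (suc t ℕ.+_) i∈
  ... | x , x∈ , e = ≡.subst (_∈ xs) (≡.sym (ℕ.+-cancelˡ-≡ (suc t) (suc i) x
    (≡.trans (≡.sym (ℕ.+-suc t (suc i))) e))) x∈

marks-partialSums : ∀ {l} t (s : Vec ℕ l) → All (1 ≤_) s →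
  Marks (_∈ partialSums (suc t ∷ s)) (replicate t false ++ flags s)
marks-partialSums t []          []       = marks-++ t (λ _ _ ()) tt
marks-partialSums t (suc u ∷ s) (_ ∷ s≥1)
  rewrite partialSums-∷ (suc t) (suc u) s =
  marks-++ t below
    ( ofʸ (here (ℕ.+-comm t 1))
    , marks-cong (replicate u false ++ flags s) (∈-shift⇔ t _) (marks-partialSums u s s≥1))
  where
  below : ∀ i → suc i ≤ t → ¬ suc i ∈ suc t ∷ List.map (suc t ℕ.+_) (partialSums (suc u ∷ s))
  below i i<t (here e)   = ℕ.<⇒≢ (s≤s i<t) e
  below i i<t (there i∈) with ∈-map⁻ (suc t ℕ.+_) i∈
  ... | x , _ , e = ℕ.<⇒≢ (s≤s (ℕ.≤-trans i<t (ℕ.m≤m+n t x))) e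

chain⇔path : ∀ {l} t (s : Vec ℕ l) → All (1 ≤_) s → ∀ i js →
  Chain (partialSums (suc t ∷ s)) (suc i ∷ js) ⇔ Path (flags (suc t ∷ s)) 0 (suc i ∷ js)
chain⇔path t s s≥1 i js = mk⇔
  (λ h → s≤s z≤n , chain⇒path (marks-partialSums t s s≥1) (suc i) js h)
  (λ (_ , p) → path⇒chain (marks-partialSums t s s≥1) (suc i) js p)

-- A ring solver with integer coefficients, so that it can cancel

module ℤ-Solver {c ℓ} (R : CommutativeRing c ℓ) where

  open CommutativeRing R
  open AbelianGroupProperties +-abelianGroup using (⁻¹-∙-comm; ε⁻¹≈ε; ⁻¹-involutive)
  open RingProperties ring using (-‿distribˡ-*; -‿distribʳ-*)
  open Mult semiring using (1+×; ×-homo-+; ×1-homo-*)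
    renaming (_×_ to infixl 8 _·_)
  open SetoidReasoning setoid

  ⟦_⟧ᶻ : ℤ → Carrier
  ⟦ + n ⟧ᶻ      = n · 1#
  ⟦ -[1+ n ] ⟧ᶻ = - (suc n · 1#)

  ⟦⟧-neg : ∀ i → ⟦ ℤ.- i ⟧ᶻ ≈ - ⟦ i ⟧ᶻ
  ⟦⟧-neg (+ zero)    = sym ε⁻¹≈ε
  ⟦⟧-neg (+ suc n)   = refl
  ⟦⟧-neg -[1+ n ]    = sym (⁻¹-involutive _)

  ⟦⟧-⊖ : ∀ m n → ⟦ m ⊖ n ⟧ᶻ ≈ m · 1# - n · 1#
  ⟦⟧-⊖ m       zero    = sym (trans (+-congˡ ε⁻¹≈ε) (+-identityʳ _))
  ⟦⟧-⊖ zero    (suc n) = sym (+-identityˡ _)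
  ⟦⟧-⊖ (suc m) (suc n) = begin
    ⟦ suc m ⊖ suc n ⟧ᶻ                       ≡⟨ ≡.cong ⟦_⟧ᶻ (ℤ.[1+m]⊖[1+n]≡m⊖n m n) ⟩
    ⟦ m ⊖ n ⟧ᶻ                               ≈⟨ ⟦⟧-⊖ m n ⟩
    m · 1# - n · 1#                          ≈⟨ +-congˡ (+-identityˡ _) ⟨
    m · 1# + (0# - n · 1#)                   ≈⟨ +-congˡ (+-congʳ (-‿inverseʳ 1#)) ⟨
    m · 1# + (1# - 1# - n · 1#)              ≈⟨ +-congˡ (+-assoc _ _ _) ⟩
    m · 1# + (1# + (- 1# - n · 1#))          ≈⟨ +-assoc _ _ _ ⟨
    m · 1# + 1# + (- 1# - n · 1#)
      ≈⟨ +-cong (trans (+-comm _ _) (sym (1+× m 1#)))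
           (trans (⁻¹-∙-comm _ _) (-‿cong (sym (1+× n 1#)))) ⟩
    suc m · 1# - suc n · 1#                  ∎

  ⟦⟧-+ : ∀ i j → ⟦ i ℤ.+ j ⟧ᶻ ≈ ⟦ i ⟧ᶻ + ⟦ j ⟧ᶻ
  ⟦⟧-+ (+ m)    (+ n)    = ×-homo-+ 1# m n
  ⟦⟧-+ (+ m)    -[1+ n ] = ⟦⟧-⊖ m (suc n)
  ⟦⟧-+ -[1+ m ] (+ n)    = trans (⟦⟧-⊖ n (suc m)) (+-comm _ _)
  ⟦⟧-+ -[1+ m ] -[1+ n ] = begin
    - (suc (suc (m ℕ.+ n)) · 1#)     ≡⟨ ≡.cong (λ k → - (suc k · 1#)) (ℕ.+-suc m n) ⟨
    - ((suc m ℕ.+ suc n) · 1#)       ≈⟨ -‿cong (×-homo-+ 1# (suc m) (suc n)) ⟩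
    - (suc m · 1# + suc n · 1#)      ≈⟨ ⁻¹-∙-comm _ _ ⟨
    - (suc m · 1#) - (suc n · 1#)    ∎

  ⟦⟧-◃- : ∀ n → ⟦ Sign.- ◃ n ⟧ᶻ ≈ - (n · 1#)
  ⟦⟧-◃- zero    = sym ε⁻¹≈ε
  ⟦⟧-◃- (suc n) = refl

  ⟦⟧-◃+ : ∀ n → ⟦ Sign.+ ◃ n ⟧ᶻ ≈ n · 1#
  ⟦⟧-◃+ zero    = refl
  ⟦⟧-◃+ (suc n) = refl

  ⟦⟧-* : ∀ i j → ⟦ i ℤ.* j ⟧ᶻ ≈ ⟦ i ⟧ᶻ * ⟦ j ⟧ᶻ
  ⟦⟧-* (+ m)    (+ n)    = trans (⟦⟧-◃+ (m ℕ.* n)) (×1-homo-* m n)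
  ⟦⟧-* (+ m)    -[1+ n ] = trans (⟦⟧-◃- (m ℕ.* suc n))
    (trans (-‿cong (×1-homo-* m (suc n))) (-‿distribʳ-* _ _))
  ⟦⟧-* -[1+ m ] (+ n)    = trans (⟦⟧-◃- (suc m ℕ.* n))
    (trans (-‿cong (×1-homo-* (suc m) n)) (-‿distribˡ-* _ _))
  ⟦⟧-* -[1+ m ] -[1+ n ] = begin
    (suc m ℕ.* suc n) · 1#               ≈⟨ ×1-homo-* (suc m) (suc n) ⟩
    (suc m · 1#) * (suc n · 1#)          ≈⟨ ⁻¹-involutive _ ⟨
    - - ((suc m · 1#) * (suc n · 1#))    ≈⟨ -‿cong (-‿distribʳ-* _ _) ⟩
    - ((suc m · 1#) * - (suc n · 1#))    ≈⟨ -‿distribˡ-* _ _ ⟩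
    - (suc m · 1#) * - (suc n · 1#)      ∎

  ℤ⟶R : CommutativeRing.rawRing ℤ.+-*-commutativeRing
           -Raw-AlmostCommutative⟶ fromCommutativeRing R
  ℤ⟶R = record
    { ⟦_⟧ = ⟦_⟧ᶻ ; +-homo = ⟦⟧-+ ; *-homo = ⟦⟧-* ; -‿homo = ⟦⟧-neg
    ; 0-homo = refl ; 1-homo = refl
    }

  coefficient≟ : ∀ i j → Maybe (⟦ i ⟧ᶻ ≈ ⟦ j ⟧ᶻ)
  coefficient≟ i j =
    Maybe.map (λ i≡j → reflexive (≡.cong ⟦_⟧ᶻ i≡j)) (dec⇒weaklyDec ℤ._≟_ i j)

  open RingSolver (CommutativeRing.rawRing ℤ.+-*-commutativeRing)
    (fromCommutativeRing R) ℤ⟶R coefficient≟ public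

module Duality {c ℓ} (K : CommutativeRing c ℓ)
  (_⁻¹ : CommutativeRing.Carrier K → CommutativeRing.Carrier K)
  (q : CommutativeRing.Carrier K) where

  open CommutativeRing K hiding (zero)
  open QAnalogues K _⁻¹ q
  open ℤ-Solver K using (solve; _:=_; _:+_; _:*_; _:-_; :-_; con)
  open Exp commutativeSemiring using (^-homo-*; ^-assocʳ; ^-congˡ; ^-distrib-*)
  open SetoidReasoning setoid

  -- The solver supplies the premise; its coefficient a is the multiplier with
  -- which the hypothesis x ≈ y enters the goal.
  linear : ∀ {x y z w} a → x ≈ y → z ≈ w + a * (x - y) → z ≈ w
  linear {x} {y} {z} {w} a x≈y e = begin
    z                  ≈⟨ e ⟩
    w + a * (x - y)    ≈⟨ +-congˡ (*-congˡ (+-congʳ x≈y)) ⟩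
    w + a * (y - y)    ≈⟨ solve 3 (λ a y w → w :+ a :* (y :- y) := w) refl a y w ⟩
    w                  ∎

  Σ< : ℕ → (ℕ → Carrier) → Carrier
  Σ< zero    f = 0#
  Σ< (suc n) f = Σ< n f + f n

  Σ<-cong-< : ∀ n {f g} → (∀ k → k < n → f k ≈ g k) → Σ< n f ≈ Σ< n g
  Σ<-cong-< zero    e = refl
  Σ<-cong-< (suc n) e =
    +-cong (Σ<-cong-< n λ k k<n → e k (ℕ.m<n⇒m<1+n k<n)) (e n ℕ.≤-refl)

  Σ<-cong : ∀ n {f g} → (∀ k → f k ≈ g k) → Σ< n f ≈ Σ< n g
  Σ<-cong n e = Σ<-cong-< n λ k _ → e k

  Σ<-+ : ∀ n f g → Σ< n (λ k → f k + g k) ≈ Σ< n f + Σ< n g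
  Σ<-+ zero    f g = sym (+-identityˡ 0#)
  Σ<-+ (suc n) f g = trans (+-congʳ (Σ<-+ n f g))
    (solve 4 (λ F G x y → (F :+ G) :+ (x :+ y) := (F :+ x) :+ (G :+ y)) refl _ _ _ _)

  Σ<-- : ∀ n f g → Σ< n (λ k → f k - g k) ≈ Σ< n f - Σ< n g
  Σ<-- zero    f g = sym (-‿inverseʳ 0#)
  Σ<-- (suc n) f g = trans (+-congʳ (Σ<-- n f g))
    (solve 4 (λ F G x y → (F :- G) :+ (x :- y) := (F :+ x) :- (G :+ y)) refl _ _ _ _)

  Σ<-* : ∀ n a f → Σ< n (λ k → a * f k) ≈ a * Σ< n f
  Σ<-* zero    a f = sym (zeroʳ a)
  Σ<-* (suc n) a f = trans (+-congʳ (Σ<-* n a f)) (sym (distribˡ a _ _))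

  Σ<-0 : ∀ n → Σ< n (λ _ → 0#) ≈ 0#
  Σ<-0 zero    = refl
  Σ<-0 (suc n) = trans (+-identityʳ _) (Σ<-0 n)

  Σ<-front : ∀ n f → Σ< (suc n) f ≈ f 0 + Σ< n (λ k → f (suc k))
  Σ<-front zero    f = +-comm 0# (f 0)
  Σ<-front (suc n) f = trans (+-congʳ (Σ<-front n f)) (+-assoc _ _ _)

  Σ<-swap : ∀ m n (f : ℕ → ℕ → Carrier) → Σ< m (λ i → Σ< n (f i)) ≈ Σ< n (λ j → Σ< m (λ i → f i j))
  Σ<-swap zero    n f = sym (Σ<-0 n)
  Σ<-swap (suc m) n f =
    trans (+-congʳ (Σ<-swap m n f)) (sym (Σ<-+ n (λ j → Σ< m (λ i → f i j)) (f m)))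

  -- Transfer operators and duality

  -- The value at 0 is set to 0 because all indices in the sums are positive.
  act : Bool → (ℕ → Carrier) → (ℕ → Carrier) → ℕ → Carrier
  act b t φ zero    = 0#
  act b t φ (suc k) = t (suc k) * Σ< (bound b (suc k)) φ

  run : ∀ {w} → Vec Bool w → Vec (ℕ → Carrier) w → (ℕ → Carrier) → ℕ → Carrier
  run []      []       φ = φ
  run (b ∷ β) (t ∷ ts) φ = run β ts (act b t φ)

  run-++ : ∀ {v w} (β : Vec Bool v) (γ : Vec Bool w) t φ →
    run (β ++ γ) (replicate (v ℕ.+ w) t) φ ≡
    run γ (replicate w t) (run β (replicate v t) φ)
  run-++ []      γ t φ = ≡.refl
  run-++ (b ∷ β) γ t φ = run-++ β γ t (act b t φ)

  run-zero : ∀ {w} (β : Vec Bool w) ts {φ} → φ 0 ≈ 0# → run β ts φ 0 ≈ 0#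
  run-zero []      []       e = e
  run-zero (b ∷ β) (t ∷ ts) e = run-zero β ts refl

  Dual : (ℕ → ℕ → Carrier) → (ℕ → Carrier) → (ℕ → Carrier) → Carrier → Set ℓ
  Dual c φ ψ ε = ∀ n → Σ< (suc n) (λ k → c n k * φ k) ≈ ε * Σ< (suc n) ψ

  Dual-cong : ∀ {c φ φ′ ψ ψ′ ε ε′} →
    (∀ k → φ k ≈ φ′ k) → (∀ k → ψ k ≈ ψ′ k) → ε ≈ ε′ →
    Dual c φ ψ ε → Dual c φ′ ψ′ ε′
  Dual-cong e f g D n = trans (Σ<-cong (suc n) λ k → *-congˡ (sym (e k)))
    (trans (D n) (*-cong g (Σ<-cong (suc n) f)))

  -- The row d n belongs to n + 1.
  module Transfer (c d : ℕ → ℕ → Carrier) (u v : ℕ → Carrier)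
    (c-above : ∀ n → c n (suc n) ≈ 0#)
    (d-zero  : ∀ n → d n 0 ≈ c n 0)
    (d-suc   : ∀ n k → d n (suc k) ≈ c n (suc k) - c n k)
    (c-step  : ∀ n k →
      (c (suc n) (suc k) - c n (suc k)) * u (suc k) ≈ v (suc n) * d n (suc k))
    where

    private
      Δ : ℕ → ℕ → Carrier
      Δ n k = c (suc n) k - c n k

    drop-last : ∀ n (φ : ℕ → Carrier) →
      Σ< (suc (suc n)) (λ k → c n k * φ k) ≈ Σ< (suc n) (λ k → c n k * φ k)
    drop-last n φ =
      trans (+-congˡ (trans (*-congʳ (c-above n)) (zeroˡ _))) (+-identityʳ _)

    telescope : ∀ {φ ψ ε} → φ 0 ≈ 0# → ψ 0 ≈ 0# →
      (∀ n → Σ< (suc (suc n)) (λ k → Δ n k * φ k) ≈ ε * ψ (suc n)) → Dual c φ ψ ε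
    telescope {φ} {ψ} {ε} φ0 ψ0 e zero = begin
      0# + c 0 0 * φ 0    ≈⟨ +-congˡ (*-congˡ φ0) ⟩
      0# + c 0 0 * 0#     ≈⟨ solve 2 (λ c ε → con (+ 0) :+ c :* con (+ 0)
                               := ε :* (con (+ 0) :+ con (+ 0))) refl (c 0 0) ε ⟩
      ε * (0# + 0#)       ≈⟨ *-congˡ (+-congˡ ψ0) ⟨
      ε * (0# + ψ 0)      ∎
    telescope {φ} {ψ} {ε} φ0 ψ0 e (suc n) = begin
      Σ< (suc (suc n)) (λ k → c (suc n) k * φ k)
        ≈⟨ Σ<-cong (suc (suc n)) (λ k → solve 3 (λ x y p →
             x :* p := y :* p :+ (x :- y) :* p) refl (c (suc n) k) (c n k) (φ k)) ⟩
      Σ< (suc (suc n)) (λ k → c n k * φ k + Δ n k * φ k)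
        ≈⟨ Σ<-+ (suc (suc n)) _ _ ⟩
      Σ< (suc (suc n)) (λ k → c n k * φ k) + Σ< (suc (suc n)) (λ k → Δ n k * φ k)
        ≈⟨ +-cong (trans (drop-last n φ) (telescope φ0 ψ0 e n)) (e n) ⟩
      ε * Σ< (suc n) ψ + ε * ψ (suc n)
        ≈⟨ distribˡ ε _ _ ⟨
      ε * Σ< (suc (suc n)) ψ ∎

    difference : ∀ {φ ψ ε} → Dual c φ ψ ε →
      ∀ n → Σ< (suc (suc n)) (λ k → Δ n k * φ k) ≈ ε * ψ (suc n)
    difference {φ} {ψ} {ε} D n = linear 1# (D (suc n))
      (linear (- 1#) (trans (drop-last n φ) (D n))
      (trans lem
        (solve 5 (λ x y ε s p →
          x :- y := ((ε :* p) :+ con (+ 1) :* (x :- ε :* (s :+ p)))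
                    :+ (:- con (+ 1)) :* (y :- ε :* s)) refl _ _ ε _ _)))
      where
      lem : Σ< (suc (suc n)) (λ k → Δ n k * φ k) ≈
        Σ< (suc (suc n)) (λ k → c (suc n) k * φ k) - Σ< (suc (suc n)) (λ k → c n k * φ k)
      lem = trans
        (Σ<-cong (suc (suc n)) λ k →
          solve 3 (λ x y p → (x :- y) :* p := x :* p :- y :* p) refl _ _ _)
        (Σ<-- (suc (suc n)) _ _)

    -- Summation by parts, with both sides moved so that no subtraction occurs.
    by-parts : ∀ n (φ : ℕ → Carrier) N →
      Σ< (suc N) (λ k → d n k * Σ< k φ) + Σ< N (λ k → c n k * φ k) ≈ c n N * Σ< N φ
    by-parts n φ zero    = solve 2 (λ c d →
      (con (+ 0) :+ d :* con (+ 0)) :+ con (+ 0) := c :* con (+ 0)) refl (c n 0) (d n 0)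
    by-parts n φ (suc N) = linear 1# (by-parts n φ N)
      (linear (Σ< (suc N) φ) (d-suc n N)
        (solve 7 (λ D C d c c′ S p →
          (D :+ d :* (S :+ p)) :+ (C :+ c :* p) :=
          (c′ :* (S :+ p) :+ con (+ 1) :* ((D :+ C) :- c :* S))
          :+ (S :+ p) :* (d :- (c′ :- c)))
          refl _ _ (d n (suc N)) (c n N) (c n (suc N)) _ (φ N)))

    by-parts-total : ∀ {φ ψ ε} → Dual c φ ψ ε → ∀ n →
      Σ< (suc (suc n)) (λ k → d n k * Σ< k φ) ≈ - (ε * Σ< (suc n) ψ)
    by-parts-total {φ} {ψ} {ε} D n = linear 1# (by-parts n φ (suc n))
      (linear (- 1#) (D n) (linear (Σ< (suc n) φ) (c-above n)
        (solve 5 (λ d c t S e →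
          d := ((:- e :+ con (+ 1) :* ((d :+ c) :- t :* S)) :+ (:- con (+ 1)) :* (c :- e))
               :+ S :* (t :- con (+ 0))) refl _ _ _ _ _)))

    dual-strict : ∀ {φ ψ ε} → Dual c φ ψ ε →
      Dual c (act true u φ) (act true v ψ) (- ε)
    dual-strict {φ} {ψ} {ε} D = telescope refl refl λ n → begin
      Σ< (suc (suc n)) (λ k → Δ n k * act true u φ k)
        ≈⟨ Σ<-cong (suc (suc n)) (term n) ⟩
      Σ< (suc (suc n)) (λ k → v (suc n) * (d n k * Σ< k φ))
        ≈⟨ Σ<-* (suc (suc n)) _ _ ⟩
      v (suc n) * Σ< (suc (suc n)) (λ k → d n k * Σ< k φ)
        ≈⟨ *-congˡ (by-parts-total D n) ⟩
      v (suc n) * - (ε * Σ< (suc n) ψ)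
        ≈⟨ solve 3 (λ v ε S → v :* (:- (ε :* S)) := (:- ε) :* (v :* S)) refl _ ε _ ⟩
      - ε * act true v ψ (suc n) ∎
      where
      term : ∀ n k → Δ n k * act true u φ k ≈ v (suc n) * (d n k * Σ< k φ)
      term n zero    = solve 3 (λ x v d → x :* con (+ 0) := v :* (d :* con (+ 0)))
                         refl (Δ n 0) (v (suc n)) (d n 0)
      term n (suc k) = linear (Σ< (suc k) φ) (c-step n k)
        (solve 5 (λ x u v d S → x :* (u :* S) :=
          v :* (d :* S) :+ S :* (x :* u :- v :* d)) refl _ _ _ _ _)

    dual-weak-sum : (w Q : ℕ → Carrier) →
      (∀ n k → c n k ≈ - (Q (suc n) * (c (suc n) (suc k) - c n (suc k)))) →
      (∀ n → w n ≈ Q n * v n) →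
      ∀ {φ ψ ε} → Dual c φ ψ ε → φ 0 ≈ 0# → ψ 0 ≈ 0# →
      Dual c (act false u φ) (λ k → w k * ψ k) ε
    dual-weak-sum w Q c-Q w-Q {φ} {ψ} {ε} D φ0 ψ0 =
      telescope refl (trans (*-congˡ ψ0) (zeroʳ _)) λ n → begin
      Σ< (suc (suc n)) (λ k → Δ n k * act false u φ k)
        ≈⟨ Σ<-cong (suc (suc n)) (term n) ⟩
      Σ< (suc (suc n)) (λ k → v (suc n) *
        (d n k * Σ< k φ + (c n k * φ k + Q (suc n) * (Δ n k * φ k))))
        ≈⟨ Σ<-* (suc (suc n)) _ _ ⟩
      v (suc n) * Σ< (suc (suc n)) (λ k →
        d n k * Σ< k φ + (c n k * φ k + Q (suc n) * (Δ n k * φ k)))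
        ≈⟨ *-congˡ (trans (Σ<-+ (suc (suc n)) _ _) (+-congˡ (Σ<-+ (suc (suc n)) _ _))) ⟩
      v (suc n) * (Σ< (suc (suc n)) (λ k → d n k * Σ< k φ) +
        (Σ< (suc (suc n)) (λ k → c n k * φ k) +
         Σ< (suc (suc n)) (λ k → Q (suc n) * (Δ n k * φ k))))
        ≈⟨ *-congˡ (+-cong (by-parts-total D n) (+-cong (trans (drop-last n φ) (D n))
             (trans (Σ<-* (suc (suc n)) _ _) (*-congˡ (difference D n))))) ⟩
      v (suc n) * (- (ε * Σ< (suc n) ψ) + (ε * Σ< (suc n) ψ + Q (suc n) * (ε * ψ (suc n))))
        ≈⟨ solve 5 (λ v ε S Q p →
             v :* (:- (ε :* S) :+ (ε :* S :+ Q :* (ε :* p))) := ε :* ((Q :* v) :* p))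
             refl _ ε _ _ _ ⟩
      ε * ((Q (suc n) * v (suc n)) * ψ (suc n))
        ≈⟨ *-congˡ (*-congʳ (w-Q (suc n))) ⟨
      ε * (w (suc n) * ψ (suc n)) ∎
      where
      term : ∀ n k → Δ n k * act false u φ k ≈
        v (suc n) * (d n k * Σ< k φ + (c n k * φ k + Q (suc n) * (Δ n k * φ k)))
      term n zero    = linear (- (v (suc n) * (c n 0 + Q (suc n) * Δ n 0))) φ0
        (solve 6 (λ D v d c Q p → D :* con (+ 0) :=
          v :* (d :* con (+ 0) :+ (c :* p :+ Q :* (D :* p))) :+
          (:- (v :* (c :+ Q :* D))) :* (p :- con (+ 0))) refl _ _ _ _ _ _)
      term n (suc k) = linear (Σ< (suc k) φ + φ (suc k)) (c-step n k)
        (linear (v (suc n) * φ (suc k)) (d-suc n k)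
        (linear (- (v (suc n) * φ (suc k))) (c-Q n k)
        (solve 9 (λ D u v d c c⁻ Q S p → D :* (u :* (S :+ p)) :=
          ((v :* (d :* S :+ (c :* p :+ Q :* (D :* p))) :+
          (S :+ p) :* (D :* u :- v :* d)) :+
          (v :* p) :* (d :- (c :- c⁻))) :+
          (:- (v :* p)) :* (c⁻ :- (:- (Q :* D)))) refl (Δ n (suc k)) _ _ _ _ _ _ _ _)))

    dual-weak-mul : (w : ℕ → Carrier) →
      (∀ n k → (c (suc n) (suc k) - c n (suc k)) * w (suc k) ≈
               w (suc n) * c (suc n) (suc k)) →
      ∀ {φ ψ ε} → Dual c φ ψ ε → φ 0 ≈ 0# →
      Dual c (λ k → w k * φ k) (act false w ψ) ε
    dual-weak-mul w c-w {φ} {ψ} {ε} D φ0 =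
      telescope (trans (*-congˡ φ0) (zeroʳ _)) refl λ n → begin
      Σ< (suc (suc n)) (λ k → Δ n k * (w k * φ k))
        ≈⟨ Σ<-cong (suc (suc n)) (term n) ⟩
      Σ< (suc (suc n)) (λ k → w (suc n) * (c (suc n) k * φ k))
        ≈⟨ Σ<-* (suc (suc n)) _ _ ⟩
      w (suc n) * Σ< (suc (suc n)) (λ k → c (suc n) k * φ k)
        ≈⟨ *-congˡ (D (suc n)) ⟩
      w (suc n) * (ε * Σ< (suc (suc n)) ψ)
        ≈⟨ solve 3 (λ w ε S → w :* (ε :* S) := ε :* (w :* S)) refl _ _ _ ⟩
      ε * act false w ψ (suc n) ∎
      where
      term : ∀ n k → Δ n k * (w k * φ k) ≈ w (suc n) * (c (suc n) k * φ k)
      term n zero    = linear (Δ n 0 * w 0 - w (suc n) * c (suc n) 0) φ0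
        (solve 5 (λ D w w′ c p → D :* (w :* p) :=
          w′ :* (c :* p) :+ (D :* w :- w′ :* c) :* (p :- con (+ 0))) refl _ _ _ _ _)
      term n (suc k) = linear (φ (suc k)) (c-w n k)
        (solve 5 (λ D w w′ c p → D :* (w :* p) :=
          w′ :* (c :* p) :+ p :* (D :* w :- w′ :* c)) refl _ _ _ _ _)

  δ : ℕ → Carrier
  δ zero    = 1#
  δ (suc k) = 0#

  Σ<-δ : ∀ n (f : ℕ → Carrier) → Σ< (suc n) (λ k → δ k * f k) ≈ f 0
  Σ<-δ n f = begin
    Σ< (suc n) (λ k → δ k * f k)
      ≈⟨ Σ<-front n _ ⟩
    1# * f 0 + Σ< n (λ k → 0# * f (suc k))
      ≈⟨ +-cong (*-identityˡ _) (trans (Σ<-cong n λ _ → zeroˡ _) (Σ<-0 n)) ⟩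
    f 0 + 0#
      ≈⟨ +-identityʳ _ ⟩
    f 0 ∎

  dual-δ : ∀ {c} → (∀ n → c n 0 ≈ 1#) → Dual c δ δ 1#
  dual-δ {c} e n = begin
    Σ< (suc n) (λ k → c n k * δ k)    ≈⟨ Σ<-cong (suc n) (λ _ → *-comm _ _) ⟩
    Σ< (suc n) (λ k → δ k * c n k)    ≈⟨ Σ<-δ n (c n) ⟩
    c n 0                             ≈⟨ e n ⟩
    1#                                ≈⟨ Σ<-δ n (λ _ → 1#) ⟨
    Σ< (suc n) (λ k → δ k * 1#)       ≈⟨ Σ<-cong (suc n) (λ _ → *-identityʳ _) ⟩
    Σ< (suc n) δ                      ≈⟨ *-identityˡ _ ⟨
    1# * Σ< (suc n) δ                 ∎

  -- Sums over constrained tuples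

  ⟦_⟧ : ∀ {p} {P : Set p} → Dec P → Carrier
  ⟦ d ⟧ = if does d then 1# else 0#

  ⟦⟧-true : ∀ {p} {P : Set p} (d : Dec P) → P → ⟦ d ⟧ ≈ 1#
  ⟦⟧-true d p = reflexive (≡.cong (if_then 1# else 0#) (dec-true d p))

  ⟦⟧-false : ∀ {p} {P : Set p} (d : Dec P) → ¬ P → ⟦ d ⟧ ≈ 0#
  ⟦⟧-false d ¬p = reflexive (≡.cong (if_then 1# else 0#) (dec-false d ¬p))

  ⟦⟧-⇔ : ∀ {p} {P Q : Set p} → P ⇔ Q → (d : Dec P) (e : Dec Q) → ⟦ d ⟧ ≈ ⟦ e ⟧
  ⟦⟧-⇔ P⇔Q d e = reflexive (≡.cong (if_then 1# else 0#) (does-⇔ P⇔Q d e))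

  ⟦⟧-× : ∀ {p} {P Q : Set p} (d : Dec P) (e : Dec Q) → ⟦ d ×-dec e ⟧ ≈ ⟦ d ⟧ * ⟦ e ⟧
  ⟦⟧-× d e with does d
  ... | true  = sym (*-identityˡ _)
  ... | false = sym (zeroˡ _)

  Σ<-below : ∀ {n j} → j ≤ n → ∀ φ → Σ< n (λ m → φ m * ⟦ m ℕ.<? j ⟧) ≈ Σ< j φ
  Σ<-below {zero}  {zero} _ φ = refl
  Σ<-below {suc n} {j}    j≤1+n φ with j ℕ.≤? n
  ... | yes j≤n = trans
    (+-cong (Σ<-below j≤n φ)
      (trans (*-congˡ (⟦⟧-false (n ℕ.<? j) (ℕ.≤⇒≯ j≤n))) (zeroʳ _)))
    (+-identityʳ _)
  ... | no  j≰n rewrite ℕ.≤-antisym j≤1+n (ℕ.≰⇒> j≰n) = Σ<-cong-< (suc n) λ m m<j →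
    trans (*-congˡ (⟦⟧-true (m ℕ.<? suc n) m<j)) (*-identityʳ _)

  Σ<-≟ : ∀ k (φ : ℕ → Carrier) → Σ< (suc k) (λ m → φ m * ⟦ m ℕ.≟ k ⟧) ≈ φ k
  Σ<-≟ k φ = begin
    Σ< k (λ m → φ m * ⟦ m ℕ.≟ k ⟧) + φ k * ⟦ k ℕ.≟ k ⟧
      ≈⟨ +-cong (Σ<-cong-< k λ m m<k →
           trans (*-congˡ (⟦⟧-false (m ℕ.≟ k) (ℕ.<⇒≢ m<k))) (zeroʳ _))
           (*-congˡ (⟦⟧-true (k ℕ.≟ k) ≡.refl)) ⟩
    Σ< k (λ _ → 0#) + φ k * 1#
      ≈⟨ +-cong (Σ<-0 k) (*-identityʳ _) ⟩
    0# + φ k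
      ≈⟨ +-identityˡ _ ⟩
    φ k ∎

  module _ {a} {A : Set a} where

    ∑-cong : (xs : List A) → ∀ {f g} → (∀ x → f x ≈ g x) → ∑ xs f ≈ ∑ xs g
    ∑-cong []       e = refl
    ∑-cong (x ∷ xs) e = +-cong (e x) (∑-cong xs e)

    ∏-cong : (xs : List A) → ∀ {f g} → (∀ x → f x ≈ g x) → ∏ xs f ≈ ∏ xs g
    ∏-cong []       e = refl
    ∏-cong (x ∷ xs) e = *-cong (e x) (∏-cong xs e)

    ∑-* : (xs : List A) → ∀ a f → ∑ xs (λ x → a * f x) ≈ a * ∑ xs f
    ∑-* []       a f = sym (zeroʳ a)
    ∑-* (x ∷ xs) a f = trans (+-congˡ (∑-* xs a f)) (sym (distribˡ a _ _))

    ∑-++ : (xs ys : List A) → ∀ f → ∑ (xs List.++ ys) f ≈ ∑ xs f + ∑ ys f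
    ∑-++ []       ys f = sym (+-identityˡ _)
    ∑-++ (x ∷ xs) ys f = trans (+-congˡ (∑-++ xs ys f)) (sym (+-assoc _ _ _))

    ∑-filter : ∀ {p} {P : A → Set p} (P? : Decidable P) xs f →
      ∑ (filter P? xs) f ≈ ∑ xs (λ x → ⟦ P? x ⟧ * f x)
    ∑-filter P? []       f = refl
    ∑-filter P? (x ∷ xs) f with does (P? x)
    ... | true  = +-cong (sym (*-identityˡ _)) (∑-filter P? xs f)
    ... | false = trans (∑-filter P? xs f)
      (sym (trans (+-congʳ (zeroˡ _)) (+-identityˡ _)))

    ∑-applyUpTo : ∀ (g : ℕ → A) f n → ∑ (applyUpTo g n) f ≈ Σ< n (λ i → f (g i))
    ∑-applyUpTo g f zero    = refl
    ∑-applyUpTo g f (suc n) =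
      trans (+-congˡ (∑-applyUpTo (g ∘ suc) f n)) (sym (Σ<-front n (f ∘ g)))

    ∏-last : ∀ (g : ℕ → A) f n →
      ∏ (applyUpTo g (suc n)) f ≈ ∏ (applyUpTo g n) f * f (g n)
    ∏-last g f zero    = *-comm _ _
    ∏-last g f (suc n) = trans (*-congˡ (∏-last (g ∘ suc) f n)) (sym (*-assoc _ _ _))

  ∑-map : ∀ {a b} {A : Set a} {B : Set b} (g : A → B) xs f →
    ∑ (List.map g xs) f ≈ ∑ xs (f ∘ g)
  ∑-map g []       f = refl
  ∑-map g (x ∷ xs) f = +-congˡ (∑-map g xs f)

  ∑-cartesianProductWith : ∀ {a b c} {A : Set a} {B : Set b} {C : Set c}
    (g : A → B → C) xs ys f →
    ∑ (cartesianProductWith g xs ys) f ≈ ∑ xs (λ x → ∑ ys (λ y → f (g x y)))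
  ∑-cartesianProductWith g []       ys f = refl
  ∑-cartesianProductWith g (x ∷ xs) ys f = trans (∑-++ (List.map (g x) ys) _ f)
    (+-cong (∑-map (g x) ys f) (∑-cartesianProductWith g xs ys f))

  ∑-tuples : ∀ n w f →
    ∑ (tuples n (suc w)) f ≈ Σ< n (λ i → ∑ (tuples n w) (λ js → f (suc i ∷ js)))
  ∑-tuples n w f =
    trans (∑-cartesianProductWith _∷_ [1⋯ n ] (tuples n w) f) (∑-applyUpTo suc _ n)

  ∏-allFin : ∀ w f → ∏ (allFin (suc w)) f ≈ f zero * ∏ (allFin w) (f ∘ suc)
  ∏-allFin w f = *-congˡ (reflexive (≡.cong (List.foldr _*_ 1#)
    (≡.trans (map-tabulate suc f) (≡.sym (map-tabulate (λ i → i) (f ∘ suc))))))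

  weight : ∀ {w} → Vec (ℕ → Carrier) w → Vec ℕ w → Carrier
  weight {w} ts js = ∏ (allFin w) λ i → lookup ts i (lookup js i)

  pathSum : ∀ {w} → Vec Bool w → Vec (ℕ → Carrier) w → ℕ → (ℕ → Carrier) → ℕ → Carrier
  pathSum {w} β ts n E m =
    ∑ (tuples n w) λ js → ⟦ path? β m js ⟧ * (weight ts js * E (end m js))

  pathSum-∷ : ∀ {w} b (β : Vec Bool w) t ts n E m → pathSum (b ∷ β) (t ∷ ts) n E m ≈
    Σ< n (λ i → ⟦ m ℕ.<? bound b (suc i) ⟧ * (t (suc i) * pathSum β ts n E (suc i)))
  pathSum-∷ {w} b β t ts n E m = trans (∑-tuples n w _) (Σ<-cong n λ i → begin
    ∑ (tuples n w) (λ js → ⟦ (m ℕ.<? bound b (suc i)) ×-dec path? β (suc i) js ⟧ *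
      (weight (t ∷ ts) (suc i ∷ js) * E (end (suc i) js)))
      ≈⟨ ∑-cong (tuples n w) (λ js → trans
           (*-cong (⟦⟧-× (m ℕ.<? bound b (suc i)) (path? β (suc i) js))
                   (*-congʳ (∏-allFin w _)))
           (solve 5 (λ d p t w E → (d :* p) :* ((t :* w) :* E) :=
             (d :* t) :* (p :* (w :* E))) refl _ _ _ _ _)) ⟩
    ∑ (tuples n w) (λ js → ⟦ m ℕ.<? bound b (suc i) ⟧ * t (suc i) *
      (⟦ path? β (suc i) js ⟧ * (weight ts js * E (end (suc i) js))))
      ≈⟨ ∑-* (tuples n w) _ _ ⟩
    ⟦ m ℕ.<? bound b (suc i) ⟧ * t (suc i) * pathSum β ts n E (suc i)
      ≈⟨ *-assoc _ _ _ ⟩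
    ⟦ m ℕ.<? bound b (suc i) ⟧ * (t (suc i) * pathSum β ts n E (suc i)) ∎)

  bound-≤ : ∀ b {i n} → i < n → bound b (suc i) ≤ suc n
  bound-≤ true  i<n = ℕ.m≤n⇒m≤1+n i<n
  bound-≤ false i<n = s≤s i<n

  pathSum-run : ∀ {w} (β : Vec Bool w) ts n E φ →
    Σ< (suc n) (λ m → φ m * pathSum β ts n E m) ≈ Σ< (suc n) (λ k → run β ts φ k * E k)
  pathSum-run []      []       n E φ = Σ<-cong (suc n) λ m → *-congˡ
    (solve 1 (λ e → con (+ 1) :* (con (+ 1) :* e) :+ con (+ 0) := e) refl (E m))
  pathSum-run (b ∷ β) (t ∷ ts) n E φ = begin
    Σ< (suc n) (λ m → φ m * pathSum (b ∷ β) (t ∷ ts) n E m)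
      ≈⟨ Σ<-cong (suc n) (λ m →
           trans (*-congˡ (pathSum-∷ b β t ts n E m)) (sym (Σ<-* n (φ m) _))) ⟩
    Σ< (suc n) (λ m → Σ< n (λ i → φ m * (d m i * (t (suc i) * S (suc i)))))
      ≈⟨ Σ<-swap (suc n) n _ ⟩
    Σ< n (λ i → Σ< (suc n) (λ m → φ m * (d m i * (t (suc i) * S (suc i)))))
      ≈⟨ Σ<-cong-< n column ⟩
    Σ< n (λ i → act b t φ (suc i) * S (suc i))
      ≈⟨ trans (+-congʳ (zeroˡ _)) (+-identityˡ _) ⟨
    0# * S 0 + Σ< n (λ i → act b t φ (suc i) * S (suc i))
      ≈⟨ Σ<-front n _ ⟨
    Σ< (suc n) (λ k → act b t φ k * S k)
      ≈⟨ pathSum-run β ts n E (act b t φ) ⟩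
    Σ< (suc n) (λ k → run β ts (act b t φ) k * E k) ∎
    where
    S = pathSum β ts n E

    d : ℕ → ℕ → Carrier
    d m i = ⟦ m ℕ.<? bound b (suc i) ⟧

    column : ∀ i → i < n → Σ< (suc n) (λ m → φ m * (d m i * (t (suc i) * S (suc i)))) ≈
      act b t φ (suc i) * S (suc i)
    column i i<n = begin
      Σ< (suc n) (λ m → φ m * (d m i * (t (suc i) * S (suc i))))
        ≈⟨ Σ<-cong (suc n) (λ m → solve 4 (λ p d t S →
             p :* (d :* (t :* S)) := (t :* S) :* (p :* d))
             refl (φ m) (d m i) (t (suc i)) (S (suc i))) ⟩
      Σ< (suc n) (λ m → t (suc i) * S (suc i) * (φ m * d m i))
        ≈⟨ Σ<-* (suc n) _ _ ⟩
      t (suc i) * S (suc i) * Σ< (suc n) (λ m → φ m * d m i)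
        ≈⟨ *-congˡ (Σ<-below (bound-≤ b i<n) φ) ⟩
      t (suc i) * S (suc i) * Σ< (bound b (suc i)) φ
        ≈⟨ solve 3 (λ t S p → (t :* S) :* p := (t :* p) :* S) refl _ _ _ ⟩
      act b t φ (suc i) * S (suc i) ∎

  pathSum-δ : ∀ {w} (β : Vec Bool w) ts n E →
    pathSum β ts n E 0 ≈ Σ< (suc n) (λ k → run β ts δ k * E k)
  pathSum-δ β ts n E = trans (sym (Σ<-δ n _)) (pathSum-run β ts n E δ)

  module _ {w} {P : Vec ℕ (suc w) → Set} (P? : Decidable P)
    (β : Vec Bool (suc w)) (ts : Vec (ℕ → Carrier) (suc w))
    (P⇔ : ∀ i js → P (suc i ∷ js) ⇔ Path β 0 (suc i ∷ js)) where

    constrained : ∀ n (E : ℕ → Carrier) (F : Vec ℕ (suc w) → Carrier) →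
      (∀ i js → F (suc i ∷ js) ≈ weight ts (suc i ∷ js) * E (end (suc i) js)) →
      ∑ (filter P? (tuples n (suc w))) F ≈ Σ< (suc n) (λ k → run β ts δ k * E k)
    constrained n E F e = begin
      ∑ (filter P? (tuples n (suc w))) F
        ≈⟨ ∑-filter P? (tuples n (suc w)) F ⟩
      ∑ (tuples n (suc w)) (λ js → ⟦ P? js ⟧ * F js)
        ≈⟨ ∑-tuples n w _ ⟩
      Σ< n (λ i → ∑ (tuples n w) (λ js → ⟦ P? (suc i ∷ js) ⟧ * F (suc i ∷ js)))
        ≈⟨ Σ<-cong n (λ i → ∑-cong (tuples n w) λ js →
             *-cong (⟦⟧-⇔ (P⇔ i js) (P? (suc i ∷ js)) (path? β 0 (suc i ∷ js))) (e i js)) ⟩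
      Σ< n (λ i → ∑ (tuples n w) (λ js → ⟦ path? β 0 (suc i ∷ js) ⟧ *
        (weight ts (suc i ∷ js) * E (end (suc i) js))))
        ≈⟨ ∑-tuples n w _ ⟨
      pathSum β ts n E 0
        ≈⟨ pathSum-δ β ts n E ⟩
      Σ< (suc n) (λ k → run β ts δ k * E k) ∎

    constrained≤ : ∀ n → ∑ (filter P? (tuples n (suc w))) (weight ts) ≈ Σ< (suc n) (run β ts δ)
    constrained≤ n = trans (constrained n (λ _ → 1#) (weight ts) λ _ _ → sym (*-identityʳ _))
      (Σ<-cong (suc n) λ _ → *-identityʳ _)

    constrained= : ∀ k → ∑ (filter (endsIn? k) (filter P? (tuples k (suc w)))) (weight ts) ≈
      run β ts δ k
    constrained= k = begin
      ∑ (filter (endsIn? k) (filter P? (tuples k (suc w)))) (weight ts)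
        ≈⟨ ∑-filter (endsIn? k) (filter P? (tuples k (suc w))) _ ⟩
      ∑ (filter P? (tuples k (suc w))) (λ js → ⟦ endsIn? k js ⟧ * weight ts js)
        ≈⟨ constrained k (λ m → ⟦ m ℕ.≟ k ⟧) _ (λ i js → trans
             (*-congʳ (⟦⟧-⇔ (endsIn⇔ k (suc i) js) (endsIn? k (suc i ∷ js)) (end (suc i) js ℕ.≟ k)))
             (*-comm _ _)) ⟩
      Σ< (suc k) (λ m → run β ts δ m * ⟦ m ℕ.≟ k ⟧)
        ≈⟨ Σ<-≟ k _ ⟩
      run β ts δ k ∎

  -- Gaussian binomial coefficients

  gauss : ℕ → ℕ → Carrier
  gauss n       zero    = 1#
  gauss zero    (suc k) = 0#
  gauss (suc n) (suc k) = gauss n k + q ^ suc k * gauss n (suc k)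

  gauss-above : ∀ {n k} → n < k → gauss n k ≈ 0#
  gauss-above {zero}  {suc k} _         = refl
  gauss-above {suc n} {suc k} (s≤s n<k) = trans
    (+-cong (gauss-above n<k) (*-congˡ (gauss-above (ℕ.m<n⇒m<1+n n<k))))
    (trans (+-identityˡ _) (zeroʳ _))

  gauss-ratio : ∀ n k → (1# - q ^ suc k) * (q ^ k * gauss n (suc k)) ≈
                        (q ^ k - q ^ n) * gauss n k
  gauss-ratio zero    zero    = solve 1 (λ q →
    (con (+ 1) :- q :* con (+ 1)) :* (con (+ 1) :* con (+ 0)) :=
    (con (+ 1) :- con (+ 1)) :* con (+ 1)) refl q
  gauss-ratio zero    (suc k) = solve 2 (λ q Q →
    (con (+ 1) :- q :* (q :* Q)) :* ((q :* Q) :* con (+ 0)) :=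
    (q :* Q :- con (+ 1)) :* con (+ 0)) refl q (q ^ k)
  gauss-ratio (suc n) zero    = linear q (gauss-ratio n zero)
    (solve 3 (λ q N B →
      (con (+ 1) :- q :* con (+ 1)) :* (con (+ 1) :* (con (+ 1) :+ (q :* con (+ 1)) :* B)) :=
      (con (+ 1) :- q :* N) :* con (+ 1) :+
      q :* ((con (+ 1) :- q :* con (+ 1)) :* (con (+ 1) :* B) :-
            (con (+ 1) :- N) :* con (+ 1)))
      refl q (q ^ n) (gauss n 1))
  gauss-ratio (suc n) (suc k) = linear q (gauss-ratio n k)
    (linear (q * (q * q ^ k)) (gauss-ratio n (suc k))
    (solve 6 (λ q Q N A B C →
      (con (+ 1) :- q :* (q :* Q)) :* ((q :* Q) :* (B :+ (q :* (q :* Q)) :* C)) :=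
      ((q :* Q :- q :* N) :* (A :+ (q :* Q) :* B) :+
      q :* ((con (+ 1) :- q :* Q) :* (Q :* B) :- (Q :- N) :* A)) :+
      (q :* (q :* Q)) :*
        ((con (+ 1) :- q :* (q :* Q)) :* ((q :* Q) :* C) :- (q :* Q :- N) :* B))
      refl q (q ^ k) (q ^ n) (gauss n k) (gauss n (suc k)) (gauss n (suc (suc k)))))

  gauss-absorb : ∀ n k → (1# - q ^ suc k) * gauss (suc n) (suc k) ≈
                         (1# - q ^ suc n) * gauss n k
  gauss-absorb n k = linear q (gauss-ratio n k)
    (solve 5 (λ q Q N A B →
      (con (+ 1) :- q :* Q) :* (A :+ (q :* Q) :* B) :=
      (con (+ 1) :- q :* N) :* A :+
      q :* ((con (+ 1) :- q :* Q) :* (Q :* B) :- (Q :- N) :* A))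
      refl q (q ^ k) (q ^ n) _ _)

  gauss-pascal′ : ∀ n k → q ^ k * gauss (suc n) (suc k) ≈
                          q ^ k * gauss n (suc k) + q ^ n * gauss n k
  gauss-pascal′ n k = linear (- 1#) (gauss-ratio n k)
    (solve 5 (λ q Q N A B →
      Q :* (A :+ (q :* Q) :* B) :=
      (Q :* B :+ N :* A) :+
      (:- con (+ 1)) :* ((con (+ 1) :- q :* Q) :* (Q :* B) :- (Q :- N) :* A))
      refl q (q ^ k) (q ^ n) _ _)

  gauss-diff : ∀ n k →
    q ^ suc k * (gauss (suc n) (suc k) - gauss n (suc k)) * (1# - q ^ suc n) ≈
    q ^ suc n * gauss (suc n) (suc k) * (1# - q ^ suc k)
  gauss-diff n k = linear (- (q * q ^ n)) (gauss-absorb n k)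
    (linear (q * (1# - q ^ suc n)) (gauss-pascal′ n k)
    (solve 5 (λ q Q N A B →
      ((q :* Q) :* ((A :+ (q :* Q) :* B) :- B)) :* (con (+ 1) :- q :* N) :=
      (((q :* N) :* (A :+ (q :* Q) :* B)) :* (con (+ 1) :- q :* Q) :+
      (:- (q :* N)) :* ((con (+ 1) :- q :* Q) :* (A :+ (q :* Q) :* B) :-
        (con (+ 1) :- q :* N) :* A)) :+
      (q :* (con (+ 1) :- q :* N)) :*
        (Q :* (A :+ (q :* Q) :* B) :- (Q :* B :+ N :* A)))
      refl q (q ^ k) (q ^ n) _ _))

  ι α : ℕ → Carrier
  ι k = [ k ]q ⁻¹
  α k = q ^ k / [ k ]q

  block : ℕ → ℕ → Carrier
  block s k = q ^ ((s ℕ.∸ 1) ℕ.* k) / [ k ]q ^ s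

  -- sgn k = (-1)ᵏ q^(k choose 2)
  sgn : ℕ → Carrier
  sgn zero    = 1#
  sgn (suc k) = - (q ^ k * sgn k)

  sgn-formula : ∀ k → (- 1#) ^ k * q ^ (k C 2) ≈ sgn k
  sgn-formula zero    = *-identityˡ 1#
  sgn-formula (suc k) = begin
    (- 1#) ^ suc k * q ^ (suc k C 2)
      ≡⟨ ≡.cong (λ m → (- 1#) ^ suc k * q ^ m) (nCk+nC[k+1]≡[n+1]C[k+1] k 1) ⟨
    (- 1#) ^ suc k * q ^ (k C 1 ℕ.+ k C 2)
      ≡⟨ ≡.cong (λ m → (- 1#) ^ suc k * q ^ (m ℕ.+ k C 2)) (nC1≡n k) ⟩
    (- 1#) ^ suc k * q ^ (k ℕ.+ k C 2)
      ≈⟨ *-congˡ (^-homo-* q k (k C 2)) ⟩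
    - 1# * (- 1#) ^ k * (q ^ k * q ^ (k C 2))
      ≈⟨ solve 3 (λ e Q x → ((:- con (+ 1)) :* e) :* (Q :* x) := :- (Q :* (e :* x))) refl _ _ _ ⟩
    - (q ^ k * ((- 1#) ^ k * q ^ (k C 2)))
      ≈⟨ -‿cong (*-congˡ (sgn-formula k)) ⟩
    sgn (suc k) ∎

  r : Carrier
  r = q ⁻¹

  -- Since r = q⁻¹, c₂ n k is (-1)ᵏ q^((k choose 2) - nk) times the binomial.
  c₁ d₁ c₂ d₂ : ℕ → ℕ → Carrier
  c₁ n k = sgn k * q ^ k * gauss n k
  d₁ n k = sgn k * gauss (suc n) k
  c₂ n k = sgn k * (r ^ n) ^ k * gauss n k
  d₂ n k = q ^ k * c₂ (suc n) k

  module _ (1≉0 : ¬ 1# ≈ 0#) (q≉0 : ¬ q ≈ 0#)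
    (1-q^≉0 : ∀ n → ¬ 1# - q ^ suc n ≈ 0#)
    (⁻¹-inverseʳ : ∀ x → ¬ x ≈ 0# → x * x ⁻¹ ≈ 1#) where

    invertible⇒≉0 : ∀ {x y} → x * y ≈ 1# → ¬ x ≈ 0#
    invertible⇒≉0 {x} {y} xy≈1 x≈0 =
      1≉0 (trans (sym xy≈1) (trans (*-congʳ x≈0) (zeroˡ y)))

    ⁻¹-unique : ∀ {x y} → x * y ≈ 1# → x ⁻¹ ≈ y
    ⁻¹-unique {x} {y} xy≈1 = linear y (⁻¹-inverseʳ x (invertible⇒≉0 xy≈1))
      (linear (- (x ⁻¹)) xy≈1
      (solve 3 (λ x x⁻¹ y → x⁻¹ :=
        (y :+ y :* (x :* x⁻¹ :- con (+ 1))) :+ (:- x⁻¹) :* (x :* y :- con (+ 1)))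
        refl x (x ⁻¹) y))

    q*r≈1 : q * r ≈ 1#
    q*r≈1 = ⁻¹-inverseʳ q q≉0

    1-q≉0 : ¬ 1# - q ≈ 0#
    1-q≉0 e = 1-q^≉0 0 (trans (+-congˡ (-‿cong (*-identityʳ q))) e)

    [suc]*ι≈1 : ∀ k → [ suc k ]q * ι (suc k) ≈ 1#
    [suc]*ι≈1 k = ⁻¹-inverseʳ _ (invertible⇒≉0 (linear (P * P ⁻¹) (⁻¹-inverseʳ D 1-q≉0)
      (linear 1# (⁻¹-inverseʳ P (1-q^≉0 k))
      (solve 4 (λ P P⁻¹ D D⁻¹ → (P :* D⁻¹) :* (D :* P⁻¹) :=
        (con (+ 1) :+ (P :* P⁻¹) :* (D :* D⁻¹ :- con (+ 1))) :+
        con (+ 1) :* (P :* P⁻¹ :- con (+ 1))) refl P (P ⁻¹) D (D ⁻¹)))))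
      where
      P = 1# - q ^ suc k
      D = 1# - q

    ι-cross : ∀ {x y} m k → x * (1# - q ^ suc m) ≈ y * (1# - q ^ suc k) →
      x * ι (suc k) ≈ y * ι (suc m)
    ι-cross {x} {y} m k e =
      linear (- (x * ι (suc k))) ([suc]*ι≈1 m)
      (linear ((1# - q) ⁻¹ * ι (suc k) * ι (suc m)) e
      (linear (y * ι (suc m)) ([suc]*ι≈1 k)
      (solve 7 (λ x y P P′ s i j → x :* i :=
        ((y :* j :+ (:- (x :* i)) :* ((P :* s) :* j :- con (+ 1))) :+
        ((s :* i) :* j) :* (x :* P :- y :* P′)) :+
        (y :* j) :* ((P′ :* s) :* i :- con (+ 1)))
        refl x y (1# - q ^ suc m) (1# - q ^ suc k) ((1# - q) ⁻¹) (ι (suc k)) (ι (suc m)))))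

    block-suc : ∀ t k → block (suc t) (suc k) ≈ α (suc k) ^ t * ι (suc k)
    block-suc t k = begin
      q ^ (t ℕ.* suc k) * (b ^ suc t) ⁻¹
        ≈⟨ *-cong (trans (reflexive (≡.cong (q ^_) (ℕ.*-comm t (suc k))))
                         (sym (^-assocʳ q (suc k) t)))
                  (⁻¹-unique (trans (sym (^-distrib-* b i (suc t)))
                    (trans (^-congˡ (suc t) ([suc]*ι≈1 k)) (1^ (suc t))))) ⟩
      (q ^ suc k) ^ t * i ^ suc t
        ≈⟨ solve 3 (λ x y i → x :* (i :* y) := (x :* y) :* i) refl _ (i ^ t) i ⟩
      ((q ^ suc k) ^ t * i ^ t) * i
        ≈⟨ *-congʳ (^-distrib-* (q ^ suc k) i t) ⟨
      α (suc k) ^ t * i ∎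
      where
      b = [ suc k ]q
      i = ι (suc k)
      1^ : ∀ t → 1# ^ t ≈ 1#
      1^ zero    = refl
      1^ (suc t) = trans (*-identityˡ _) (1^ t)

    act-block : ∀ t φ k → α k ^ t * act true ι φ k ≈ act true (block (suc t)) φ k
    act-block t φ zero    = zeroʳ _
    act-block t φ (suc k) = trans (sym (*-assoc _ _ _)) (*-congʳ (sym (block-suc t k)))

    c₁-step : ∀ n k → (c₁ (suc n) (suc k) - c₁ n (suc k)) * ι (suc k) ≈
                      α (suc n) * d₁ n (suc k)
    c₁-step n k = linear (sgn (suc k)) (ι-cross n k (gauss-diff n k))
      (solve 7 (λ Q N S A B i j →
        ((S :* Q) :* A :- (S :* Q) :* B) :* i := (N :* j) :* (S :* A) :+
        S :* ((Q :* (A :- B)) :* i :- (N :* A) :* j))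
        refl (q ^ suc k) (q ^ suc n) (sgn (suc k)) (gauss (suc n) (suc k)) _
        (ι (suc k)) (ι (suc n)))

    d₁-suc : ∀ n k → d₁ n (suc k) ≈ c₁ n (suc k) - c₁ n k
    d₁-suc n k = solve 5 (λ q Q S A B →
      (:- (Q :* S)) :* (A :+ (q :* Q) :* B) :=
      ((:- (Q :* S)) :* (q :* Q)) :* B :- (S :* Q) :* A) refl q (q ^ k) (sgn k) _ _

    gauss-zero⇒ : ∀ n x → x * gauss n (suc n) ≈ 0#
    gauss-zero⇒ n x = trans (*-congˡ (gauss-above {n} ℕ.≤-refl)) (zeroʳ x)

    module T₁ = Transfer c₁ d₁ ι α (λ n → gauss-zero⇒ n _)
      (λ n → sym (*-identityʳ _)) d₁-suc c₁-step

    -- Multiplying the step relation of T₁ by qᵏ turns ι into α and d₁ into c₁.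
    c₁-weak : ∀ n k → (c₁ (suc n) (suc k) - c₁ n (suc k)) * α (suc k) ≈
                      α (suc n) * c₁ (suc n) (suc k)
    c₁-weak n k = linear (q ^ suc k * sgn (suc k)) (ι-cross n k (gauss-diff n k))
        (solve 7 (λ Q N S A B i j →
          ((S :* Q) :* A :- (S :* Q) :* B) :* (Q :* i) := (N :* j) :* ((S :* Q) :* A) :+
          (Q :* S) :* ((Q :* (A :- B)) :* i :- (N :* A) :* j))
          refl (q ^ suc k) (q ^ suc n) (sgn (suc k)) (gauss (suc n) (suc k)) _
          (ι (suc k)) (ι (suc n)))

    q^*r^≈1 : ∀ n → q ^ n * r ^ n ≈ 1#
    q^*r^≈1 zero    = *-identityˡ 1#
    q^*r^≈1 (suc n) = linear (q ^ n * r ^ n) q*r≈1 (linear 1# (q^*r^≈1 n)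
      (solve 4 (λ q r Q R → (q :* Q) :* (r :* R) :=
        (con (+ 1) :+ (Q :* R) :* (q :* r :- con (+ 1))) :+
        con (+ 1) :* (Q :* R :- con (+ 1))) refl q r (q ^ n) (r ^ n)))

    c₂-suc : ∀ n k → c₂ (suc n) k ≈ sgn k * (r ^ k * (r ^ n) ^ k) * gauss (suc n) k
    c₂-suc n k = *-congʳ (*-congˡ (^-distrib-* r (r ^ n) k))

    c₂-diff : ∀ n k → c₂ (suc n) (suc k) - c₂ n (suc k) ≈ - (r * r ^ n * c₂ n k)
    c₂-diff n k = linear 1# (c₂-suc n (suc k))
      (linear (- (q ^ k * sgn k) * (r ^ n * (r ^ n) ^ k) * gauss n (suc k)) (q^*r^≈1 (suc k))
      (linear (- (sgn k * (r ^ n * (r ^ n) ^ k) * r * gauss n k)) (q^*r^≈1 k)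
      (solve 10 (λ Z q Q S r R M T A B →
        Z :- ((:- (Q :* S)) :* (M :* T)) :* B :=
        (((:- ((r :* M) :* ((S :* T) :* A))) :+
        con (+ 1) :* (Z :- ((:- (Q :* S)) :* ((r :* R) :* (M :* T))) :* (A :+ (q :* Q) :* B))) :+
        (((:- (Q :* S)) :* (M :* T)) :* B) :* ((q :* Q) :* (r :* R) :- con (+ 1))) :+
        (:- (((S :* (M :* T)) :* r) :* A)) :* (Q :* R :- con (+ 1)))
        refl (c₂ (suc n) (suc k)) q (q ^ k) (sgn k) r (r ^ k) (r ^ n) ((r ^ n) ^ k)
        (gauss n k) (gauss n (suc k)))))

    d₂-suc : ∀ n k → d₂ n (suc k) ≈ c₂ n (suc k) - c₂ n k
    d₂-suc n k = linear (q ^ suc k) (c₂-suc n (suc k))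
      (linear (- (q ^ k * sgn k) * (r ^ n * (r ^ n) ^ k) * gauss (suc n) (suc k)) (q^*r^≈1 (suc k))
      (linear (- (sgn k * (r ^ n * (r ^ n) ^ k))) (gauss-pascal′ n k)
      (linear (- (sgn k * (r ^ n) ^ k * gauss n k)) (q^*r^≈1 n)
      (solve 12 (λ Z q Q N S r R M T G A B →
        (q :* Q) :* Z :=
        ((((((:- (Q :* S)) :* (M :* T)) :* B :- (S :* T) :* A) :+
        (q :* Q) :* (Z :- ((:- (Q :* S)) :* ((r :* R) :* (M :* T))) :* G)) :+
        (((:- (Q :* S)) :* (M :* T)) :* G) :* ((q :* Q) :* (r :* R) :- con (+ 1))) :+
        (:- (S :* (M :* T))) :* (Q :* G :- (Q :* B :+ N :* A))) :+
        (:- ((S :* T) :* A)) :* (N :* M :- con (+ 1)))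
        refl (c₂ (suc n) (suc k)) q (q ^ k) (q ^ n) (sgn k) r (r ^ k) (r ^ n) ((r ^ n) ^ k)
        (gauss (suc n) (suc k)) (gauss n k) (gauss n (suc k))))))

    c₂-ratio : ∀ n k → (c₂ (suc n) (suc k) - c₂ n (suc k)) * (1# - q ^ suc n) ≈
                       c₂ (suc n) (suc k) * (1# - q ^ suc k)
    c₂-ratio n k = linear (1# - q ^ suc n) (c₂-diff n k)
      (linear (- (1# - q ^ suc k)) (c₂-suc n (suc k))
      (linear (q ^ k * sgn k * (r * r ^ k * (r ^ n * (r ^ n) ^ k))) (gauss-absorb n k)
      (linear (sgn k * (r ^ n) ^ k * gauss n k * r * r ^ n * (1# - q ^ suc n)) (q^*r^≈1 k)
      (solve 12 (λ Z Y P P′ Q S r R M T G A →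
        (Z :- Y) :* P′ :=
        (((Z :* P :+
        P′ :* ((Z :- Y) :- (:- ((r :* M) :* ((S :* T) :* A))))) :+
        (:- P) :* (Z :- ((:- (Q :* S)) :* ((r :* R) :* (M :* T))) :* G)) :+
        ((Q :* S) :* ((r :* R) :* (M :* T))) :* (P :* G :- P′ :* A)) :+
        (((((S :* T) :* A) :* r) :* M) :* P′) :* (Q :* R :- con (+ 1)))
        refl (c₂ (suc n) (suc k)) (c₂ n (suc k)) (1# - q ^ suc k) (1# - q ^ suc n)
        (q ^ k) (sgn k) r (r ^ k) (r ^ n) ((r ^ n) ^ k) (gauss (suc n) (suc k)) (gauss n k)))))

    c₂-step : ∀ n k → (c₂ (suc n) (suc k) - c₂ n (suc k)) * α (suc k) ≈
                      ι (suc n) * d₂ n (suc k)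
    c₂-step n k = linear (q ^ suc k) (ι-cross n k (c₂-ratio n k))
      (solve 5 (λ D Q Z i j →
        D :* (Q :* i) := j :* (Q :* Z) :+ Q :* (D :* i :- Z :* j)) refl _ _ _ _ _)

    c₂-shift : ∀ n k → c₂ n k ≈ - (q ^ suc n * (c₂ (suc n) (suc k) - c₂ n (suc k)))
    c₂-shift n k = linear (- (c₂ n k)) (q^*r^≈1 (suc n))
      (linear (q ^ suc n) (c₂-diff n k)
      (solve 4 (λ D N M C →
        C := ((:- (N :* D)) :+ (:- C) :* (N :* M :- con (+ 1))) :+
        N :* (D :- (:- (M :* C)))) refl _ _ _ _))

    c₂-zero : ∀ n → d₂ n 0 ≈ c₂ n 0
    c₂-zero n = *-identityˡ _

    module T₂ = Transfer c₂ d₂ α ι (λ n → gauss-zero⇒ n _) c₂-zero d₂-suc c₂-step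

    -- Duality along the whole word

    mul-zero : ∀ {ψ : ℕ → Carrier} (w : ℕ → Carrier) → ψ 0 ≈ 0# → w 0 * ψ 0 ≈ 0#
    mul-zero w ψ0 = trans (*-congˡ ψ0) (zeroʳ (w 0))

    ^-shift : ∀ t (ψ : ℕ → Carrier) k → α k ^ t * (α k * ψ k) ≈ α k ^ suc t * ψ k
    ^-shift t ψ k = solve 3 (λ x y p → x :* (y :* p) := (y :* x) :* p) refl (α k ^ t) (α k) (ψ k)

    dual₁-weak : ∀ t {φ ψ ε} → Dual c₁ φ ψ ε → φ 0 ≈ 0# →
      Dual c₁ (λ k → α k ^ t * φ k) (run (replicate t false) (replicate t α) ψ) ε
    dual₁-weak zero    D φ0 = Dual-cong (λ k → sym (*-identityˡ _)) (λ _ → refl) refl D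
    dual₁-weak (suc t) {φ} D φ0 = Dual-cong (^-shift t φ) (λ _ → refl) refl
      (dual₁-weak t (T₁.dual-weak-mul α c₁-weak D φ0) (mul-zero {φ} α φ0))

    dual₂-weak : ∀ t {φ ψ ε} → Dual c₂ φ ψ ε → φ 0 ≈ 0# → ψ 0 ≈ 0# →
      Dual c₂ (run (replicate t false) (replicate t α) φ) (λ k → α k ^ t * ψ k) ε
    dual₂-weak zero    D φ0 ψ0 = Dual-cong (λ _ → refl) (λ k → sym (*-identityˡ _)) refl D
    dual₂-weak (suc t) {ψ = ψ} D φ0 ψ0 = Dual-cong (λ _ → refl) (^-shift t ψ) refl
      (dual₂-weak t (T₂.dual-weak-sum α (q ^_) c₂-shift (λ _ → refl) D φ0 ψ0) refl
        (mul-zero {ψ} α ψ0))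

    strictRun chainRun : ∀ {l} → Vec ℕ l → (ℕ → Carrier) → ℕ → Carrier
    strictRun {l} s = run (replicate l true) (Vec.map block s)
    chainRun      s = run (flags s) (replicate (Vec.sum s) α)

    chainRun-∷ : ∀ {l} t (s : Vec ℕ l) φ → chainRun (suc t ∷ s) φ ≡
      chainRun s (run (replicate t false) (replicate t α) (act true α φ))
    chainRun-∷ t s φ = run-++ (replicate t false) (flags s) α (act true α φ)

    sign-suc : ∀ l ε → (- 1#) ^ l * - ε ≈ (- 1#) ^ suc l * ε
    sign-suc l ε = solve 2 (λ x ε → x :* (:- ε) := ((:- con (+ 1)) :* x) :* ε) refl _ ε

    dual₁-word : ∀ {l} (s : Vec ℕ l) → All (1 ≤_) s → ∀ {φ ψ ε} → Dual c₁ φ ψ ε →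
      Dual c₁ (strictRun s φ) (chainRun s ψ) ((- 1#) ^ l * ε)
    dual₁-word []          []        D = Dual-cong (λ _ → refl) (λ _ → refl) (sym (*-identityˡ _)) D
    dual₁-word {suc l} (suc t ∷ s) (_ ∷ s≥1) {φ} {ψ} {ε} D = Dual-cong (λ _ → refl)
      (λ k → reflexive (≡.cong (λ f → f k) (≡.sym (chainRun-∷ t s ψ)))) (sign-suc l ε)
      (dual₁-word s s≥1 (Dual-cong (act-block t φ) (λ _ → refl) refl
        (dual₁-weak t (T₁.dual-strict D) refl)))

    dual₂-word : ∀ {l} (s : Vec ℕ l) → All (1 ≤_) s → ∀ {φ ψ ε} → Dual c₂ φ ψ ε →
      Dual c₂ (chainRun s φ) (strictRun s ψ) ((- 1#) ^ l * ε)
    dual₂-word []          []        D = Dual-cong (λ _ → refl) (λ _ → refl) (sym (*-identityˡ _)) D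
    dual₂-word {suc l} (suc t ∷ s) (_ ∷ s≥1) {φ} {ψ} {ε} D = Dual-cong
      (λ k → reflexive (≡.cong (λ f → f k) (≡.sym (chainRun-∷ t s φ)))) (λ _ → refl) (sign-suc l ε)
      (dual₂-word s s≥1 (Dual-cong (λ _ → refl) (act-block t ψ) refl
        (dual₂-weak t (T₂.dual-strict D) refl refl)))

    qBinomial≈gauss : ∀ {n k} → k ≤ n → qBinomial n k ≈ gauss n k
    qBinomial≈gauss {n} {k} k≤n = begin
      qBinomial n k
        ≡⟨ ≡.cong (λ m → qBinomial m k) (ℕ.m∸n+n≡m k≤n) ⟨
      qBinomial (n ℕ.∸ k ℕ.+ k) k
        ≡⟨ ≡.cong (λ d → ∏ [1⋯ k ] (ratio d)) (ℕ.m+n∸n≡m (n ℕ.∸ k) k) ⟩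
      ∏ [1⋯ k ] (ratio (n ℕ.∸ k))
        ≈⟨ product (n ℕ.∸ k) k ⟩
      gauss (n ℕ.∸ k ℕ.+ k) k
        ≡⟨ ≡.cong (λ m → gauss m k) (ℕ.m∸n+n≡m k≤n) ⟩
      gauss n k ∎
      where
      ratio : ℕ → ℕ → Carrier
      ratio d j = (1# - q ^ (d ℕ.+ j)) / (1# - q ^ j)

      product : ∀ d k → ∏ [1⋯ k ] (ratio d) ≈ gauss (d ℕ.+ k) k
      product d zero    = refl
      product d (suc k) = trans (∏-last suc (ratio d) k) (begin
        ∏ [1⋯ k ] (ratio d) * ratio d (suc k)
          ≈⟨ *-congʳ (product d k) ⟩
        gauss (d ℕ.+ k) k * ((1# - q ^ (d ℕ.+ suc k)) * i)
          ≡⟨ ≡.cong (λ m → gauss (d ℕ.+ k) k * ((1# - q ^ m) * i)) (ℕ.+-suc d k) ⟩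
        gauss (d ℕ.+ k) k * ((1# - q ^ suc (d ℕ.+ k)) * i)
          ≈⟨ linear (- i) (gauss-absorb (d ℕ.+ k) k)
               (linear (gauss (suc (d ℕ.+ k)) (suc k)) (⁻¹-inverseʳ _ (1-q^≉0 k))
               (solve 5 (λ A G P P′ i → A :* (P′ :* i) :=
                 (G :+ (:- i) :* (P :* G :- P′ :* A)) :+ G :* (P :* i :- con (+ 1)))
                 refl (gauss (d ℕ.+ k) k) (gauss (suc (d ℕ.+ k)) (suc k))
                 (1# - q ^ suc k) (1# - q ^ suc (d ℕ.+ k)) i)) ⟩
        gauss (suc (d ℕ.+ k)) (suc k)
          ≡⟨ ≡.cong (λ m → gauss m (suc k)) (ℕ.+-suc d k) ⟨
        gauss (d ℕ.+ suc k) (suc k) ∎)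
        where i = (1# - q ^ suc k) ⁻¹

    c₁-formula : ∀ {n k} → k ≤ n →
      qBinomial n k * (- 1#) ^ k * q ^ (k C 2 ℕ.+ k) ≈ c₁ n k
    c₁-formula {n} {k} k≤n = begin
      qBinomial n k * (- 1#) ^ k * q ^ (k C 2 ℕ.+ k)
        ≈⟨ *-cong (*-congʳ (qBinomial≈gauss k≤n)) (^-homo-* q (k C 2) k) ⟩
      gauss n k * (- 1#) ^ k * (q ^ (k C 2) * q ^ k)
        ≈⟨ solve 4 (λ g e x y → (g :* e) :* (x :* y) := ((e :* x) :* y) :* g) refl _ _ _ _ ⟩
      (- 1#) ^ k * q ^ (k C 2) * q ^ k * gauss n k
        ≈⟨ *-congʳ (*-congʳ (sgn-formula k)) ⟩
      c₁ n k ∎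

    c₂-formula : ∀ {n k} → k ≤ n →
      qBinomial n k * (- 1#) ^ k * q ^ℤ (+ (k C 2) ℤ.- + (n ℕ.* k)) ≈ c₂ n k
    c₂-formula {n} {k} k≤n = begin
      qBinomial n k * (- 1#) ^ k * q ^ℤ (+ (k C 2) ℤ.- + (n ℕ.* k))
        ≈⟨ *-cong (*-congʳ (qBinomial≈gauss k≤n)) (trans
             (reflexive (≡.cong (q ^ℤ_) (ℤ.m-n≡m⊖n (k C 2) (n ℕ.* k))))
             (^ℤ-⊖ (k C 2) (n ℕ.* k))) ⟩
      gauss n k * (- 1#) ^ k * (q ^ (k C 2) * r ^ (n ℕ.* k))
        ≈⟨ solve 4 (λ g e x y → (g :* e) :* (x :* y) := ((e :* x) :* y) :* g) refl _ _ _ _ ⟩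
      (- 1#) ^ k * q ^ (k C 2) * r ^ (n ℕ.* k) * gauss n k
        ≈⟨ *-congʳ (*-cong (sgn-formula k) (sym (^-assocʳ r n k))) ⟩
      c₂ n k ∎
      where
      ^ℤ-⊖ : ∀ a b → q ^ℤ (a ⊖ b) ≈ q ^ a * r ^ b
      ^ℤ-⊖ a       zero    = sym (*-identityʳ _)
      ^ℤ-⊖ zero    (suc b) = sym (*-identityˡ _)
      ^ℤ-⊖ (suc a) (suc b) = begin
        q ^ℤ (suc a ⊖ suc b)           ≡⟨ ≡.cong (q ^ℤ_) (ℤ.[1+m]⊖[1+n]≡m⊖n a b) ⟩
        q ^ℤ (a ⊖ b)                   ≈⟨ ^ℤ-⊖ a b ⟩
        q ^ a * r ^ b                  ≈⟨ *-identityˡ _ ⟨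
        1# * (q ^ a * r ^ b)           ≈⟨ *-congʳ q*r≈1 ⟨
        q * r * (q ^ a * r ^ b)        ≈⟨ solve 4 (λ q r x y → (q :* r) :* (x :* y) :=
                                            (q :* x) :* (r :* y)) refl q r _ _ ⟩
        q ^ suc a * r ^ suc b          ∎

    transform : (c : ℕ → ℕ → Carrier) (coeff inner : ℕ → Carrier) → ∀ n {φ ψ ε} →
      (∀ {k} → k ≤ n → coeff k ≈ c n k) →
      (∀ k → inner (suc k) ≈ φ (suc k)) → φ 0 ≈ 0# → Dual c φ ψ ε →
      ∑ [1⋯ n ] (λ k → coeff k * inner k) ≈ ε * Σ< (suc n) ψ
    transform c coeff inner n {φ} {ψ} {ε} e f φ0 D = begin
      ∑ [1⋯ n ] (λ k → coeff k * inner k)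
        ≈⟨ ∑-applyUpTo suc _ n ⟩
      Σ< n (λ k → coeff (suc k) * inner (suc k))
        ≈⟨ Σ<-cong-< n (λ k k<n → *-cong (e k<n) (f k)) ⟩
      Σ< n (λ k → c n (suc k) * φ (suc k))
        ≈⟨ trans (+-congʳ (trans (*-congˡ φ0) (zeroʳ _))) (+-identityˡ _) ⟨
      c n 0 * φ 0 + Σ< n (λ k → c n (suc k) * φ (suc k))
        ≈⟨ Σ<-front n _ ⟨
      Σ< (suc n) (λ k → c n k * φ k)
        ≈⟨ D n ⟩
      ε * Σ< (suc n) ψ ∎

    duality : (l n : ℕ) (s : Vec ℕ l) → 1 ≤ l → All (1 ≤_) s →
      let w = Vec.sum s
          I = partialSums s
      in
        (∑[ k ∈ [1⋯ n ] ] (qBinomial n k * (- 1#) ^ k * q ^ (k C 2 ℕ.+ k) *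
            (∑[ ks ∈ strictTuples= k l ] strictTerm s ks))
          ≈ (- 1#) ^ l * (∑[ js ∈ chains≤ I n w ] chainTerm js))
        ×
        (∑[ k ∈ [1⋯ n ] ] (qBinomial n k * (- 1#) ^ k * q ^ℤ (+ (k C 2) ℤ.- + (n ℕ.* k)) *
            (∑[ js ∈ chains= I k w ] chainTerm js))
          ≈ (- 1#) ^ l * (∑[ ks ∈ strictTuples≤ n l ] strictTerm s ks))
    duality (suc l) n s@(suc t ∷ s′) _ s≥1@(_ ∷ s′≥1) =
      trans
        (transform c₁ (λ k → qBinomial n k * (- 1#) ^ k * q ^ (k C 2 ℕ.+ k))
          (λ k → ∑[ ks ∈ strictTuples= k (suc l) ] strictTerm s ks) n c₁-formula
          (λ k → strict= (suc k))
          (run-zero (replicate l true) (Vec.map block s′) refl)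
          (dual₁-word s s≥1 (dual-δ λ _ → trans (*-identityʳ _) (*-identityʳ _))))
        (*-cong (*-identityʳ _) (sym (chain≤ n))) ,
      trans
        (transform c₂ (λ k → qBinomial n k * (- 1#) ^ k * q ^ℤ (+ (k C 2) ℤ.- + (n ℕ.* k)))
          (λ k → ∑[ js ∈ chains= (partialSums s) k (Vec.sum s) ] chainTerm js) n c₂-formula
          (λ k → chain= (suc k))
          (run-zero (replicate t false ++ flags s′) (replicate (t ℕ.+ Vec.sum s′) α) refl)
          (dual₂-word s s≥1 (dual-δ λ _ → trans (*-identityʳ _) (*-identityʳ _))))
        (*-cong (*-identityʳ _) (sym (strict≤ n)))
      where
      strictWeight : ∀ ks → strictTerm s ks ≈ weight (Vec.map block s) ks
      strictWeight ks = ∏-cong (allFin (suc l)) λ i →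
        reflexive (≡.cong (λ f → f (lookup ks i)) (≡.sym (lookup-map i block s)))

      chainWeight : ∀ js → chainTerm js ≈ weight (replicate (Vec.sum s) α) js
      chainWeight js = ∏-cong (allFin (Vec.sum s)) λ i →
        reflexive (≡.cong (λ f → f (lookup js i)) (≡.sym (lookup-replicate i α)))

      linked⇔ : ∀ i (ks : Vec ℕ l) →
        Linked _<_ (suc i ∷ ks) ⇔ Path (replicate (suc l) true) 0 (suc i ∷ ks)
      linked⇔ i ks = mk⇔ (λ L → s≤s z≤n , Equivalence.to (linked⇔path (suc i) ks) L)
        (λ (_ , p) → Equivalence.from (linked⇔path (suc i) ks) p)

      strict≤ : ∀ n → ∑ (strictTuples≤ n (suc l)) (strictTerm s) ≈ Σ< (suc n) (strictRun s δ)
      strict≤ n = trans (∑-cong (strictTuples≤ n (suc l)) strictWeight)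
        (constrained≤ (linked? ℕ._<?_) (replicate (suc l) true) (Vec.map block s) linked⇔ n)

      strict= : ∀ k → ∑ (strictTuples= k (suc l)) (strictTerm s) ≈ strictRun s δ k
      strict= k = trans (∑-cong (strictTuples= k (suc l)) strictWeight)
        (constrained= (linked? ℕ._<?_) (replicate (suc l) true) (Vec.map block s) linked⇔ k)

      chain≤ : ∀ n → ∑ (chains≤ (partialSums s) n (Vec.sum s)) chainTerm ≈ Σ< (suc n) (chainRun s δ)
      chain≤ n = trans (∑-cong (chains≤ (partialSums s) n (Vec.sum s)) chainWeight)
        (constrained≤ (chain? (partialSums s)) (flags s) (replicate (Vec.sum s) α)
          (chain⇔path t s′ s′≥1) n)

      chain= : ∀ k → ∑ (chains= (partialSums s) k (Vec.sum s)) chainTerm ≈ chainRun s δ k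
      chain= k = trans (∑-cong (chains= (partialSums s) k (Vec.sum s)) chainWeight)
        (constrained= (chain? (partialSums s)) (flags s) (replicate (Vec.sum s) α)
          (chain⇔path t s′ s′≥1) k)

open import Defs

coeff₀-* : ∀ p t → ℚ[q].coeff (p ℚ[q].* t) 0 ≡ ℚ[q].coeff p 0 ℚ.* ℚ[q].coeff t 0
coeff₀-* []      t       = ≡.sym (ℚ.*-zeroˡ (ℚ[q].coeff t 0))
coeff₀-* (a ∷ p) []      = ≡.sym (ℚ.*-zeroʳ a)
coeff₀-* (a ∷ p) (b ∷ t) = ℚ.+-identityʳ _

coeff₀-den-q^ : ∀ n → ℚ[q].coeff (ℚ⟨q⟩.Fraction.den (q ^ n)) 0 ≡ ℚ.1ℚ
coeff₀-den-q^ zero    = ≡.refl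
coeff₀-den-q^ (suc n) = ≡.trans (coeff₀-* ℚ[q].1ₚ (ℚ⟨q⟩.Fraction.den (q ^ n)))
  (≡.trans (ℚ.*-identityˡ _) (coeff₀-den-q^ n))

q≉0 : ¬ q ≈ 0#
q≉0 (ℚ⟨q⟩.cross e) with () ← ℚ[q]._≈_.at e 1

1≉0 : ¬ 1# ≈ 0#
1≉0 (ℚ⟨q⟩.cross e) with () ← ℚ[q]._≈_.at e 0

-- The constant coefficient of qⁿ⁺¹ vanishes.
1≉q^suc : ∀ n → ¬ 1# ≈ q ^ suc n
1≉q^suc n (ℚ⟨q⟩.cross e) = absurd (begin
  ℚ.1ℚ
    ≡⟨ coeff₀-den-q^ (suc n) ⟨
  ℚ[q].coeff den 0
    ≡⟨ ≡.trans (coeff₀-* ℚ[q].1ₚ den) (ℚ.*-identityˡ _) ⟨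
  ℚ[q].coeff (ℚ[q].1ₚ ℚ[q].* den) 0
    ≡⟨ ℚ[q]._≈_.at e 0 ⟩
  ℚ[q].coeff (ℚ[q].X ℚ[q].* num ℚ[q].* ℚ[q].1ₚ) 0
    ≡⟨ ≡.trans (coeff₀-* (ℚ[q].X ℚ[q].* num) ℚ[q].1ₚ) (ℚ.*-identityʳ _) ⟩
  ℚ[q].coeff (ℚ[q].X ℚ[q].* num) 0
    ≡⟨ ≡.trans (coeff₀-* ℚ[q].X num) (ℚ.*-zeroˡ (ℚ[q].coeff num 0)) ⟩
  ℚ.0ℚ ∎)
  where
  open ≡.≡-Reasoning
  num = ℚ⟨q⟩.Fraction.num (q ^ n)
  den = ℚ⟨q⟩.Fraction.den (q ^ suc n)

  absurd : ¬ ℚ.1ℚ ≡ ℚ.0ℚ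
  absurd ()

1-q^suc≉0 : ∀ n → ¬ 1# - q ^ suc n ≈ 0#
1-q^suc≉0 n e = 1≉q^suc n
  (GroupProperties.x∙y⁻¹≈ε⇒x≈y (CommutativeRing.+-group ℚ⟨q⟩.fractionField) 1# (q ^ suc n) e)

theorem8p1 : (l n : ℕ) (s : Vec ℕ l) → 1 ≤ l → 1 ≤ n → All (1 ≤_) s →
    let w = Vec.sum s
        I = partialSums s
    in
      (∑[ k ∈ [1⋯ n ] ] (qBinomial n k * (- 1#) ^ k * q ^ (k C 2 ℕ.+ k) *
          (∑[ ks ∈ strictTuples= k l ] strictTerm s ks))
        ≈ (- 1#) ^ l * (∑[ js ∈ chains≤ I n w ] chainTerm js))
      ×
      (∑[ k ∈ [1⋯ n ] ] (qBinomial n k * (- 1#) ^ k * q ^ℤ (+ (k C 2) ℤ.- + (n ℕ.* k)) *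
          (∑[ js ∈ chains= I k w ] chainTerm js))
        ≈ (- 1#) ^ l * (∑[ ks ∈ strictTuples≤ n l ] strictTerm s ks))
theorem8p1 l n s l≥1 _ s≥1 =
  Duality.duality ℚ⟨q⟩.fractionField ℚ⟨q⟩._⁻¹ q
    1≉0 q≉0 1-q^suc≉0 ℚ⟨q⟩.⁻¹-inverseʳ l n s l≥1 s≥1
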